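{- The following series identity holds: $$\sum_{k=0}^{\infty}\frac{(1)_k}{(\frac{3}{2})_k(1+2k)}\left\{H_{1+2k}^{(2)}-\frac{1}{4}H_{k}^{(2)}\right\}=2\beta(4).$$
   Context: For a complex number $x$ and a nonnegative integer $n$, the shifted factorial is $(x)_0=1$ and $(x)_n=x(x+1)\cdots(x+n-1)$ for $n\ge 1$. The harmonic numbers of order 2 are $H_n^{(2)}=\sum_{j=1}^n \frac{1}{j^2}$, with $H_0^{(2)}=0$. The constant $\beta(4)$ is $\beta(4)=\sum_{k=0}^{\infty}\frac{(-1)^k}{(1+2k)^4}$. -}

module Defs where

open import Data.Integer as ℤ using (ℤ; +_; -[1+_]; +[1+_]; -1ℤ; 1ℤ; +≤+; +<+)
import Data.Integer.Properties as ℤ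
open import Data.Nat as ℕ using (ℕ; zero; suc)
import Data.Nat.Properties as ℕ
import Data.Nat.Tactic.RingSolver as ℕ-Solver
open import Data.Product using (Σ-syntax; ∃-syntax; _×_; _,_; proj₁; proj₂)
open import Data.Rational
open import Data.Rational.Properties
open import Data.Rational.Solver using (module +-*-Solver)
open import Data.Rational.Unnormalised as ℚᵘ using (mkℚᵘ)
import Data.Rational.Unnormalised.Properties as ℚᵘ
open import Data.Sum using (_⊎_; inj₁; inj₂)
open import Function using (_∘_)
open import Relation.Binary.PropositionalEquality

IsCauchy : (ℕ → ℚ) → Set
IsCauchy s = ∀ ε → 0ℚ < ε →
  ∃[ N ] (∀ m n → N ℕ.≤ m → N ℕ.≤ n → ∣ s m - s n ∣ < ε)

record ℝ : Set where
  constructor mkℝ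
  field
    approx   : ℕ → ℚ
    isCauchy : IsCauchy approx

open ℝ public

infix 4 _<ℝ_
-- Constructively, x < y means that the approximations are eventually separated
-- by a fixed positive rational δ.
_<ℝ_ : ℝ → ℝ → Set
x <ℝ y = Σ[ δ ∈ ℚ ] 0ℚ < δ ×
  ∃[ N ] (∀ n → N ℕ.≤ n → approx x n + δ < approx y n)

private
  half-pos : ∀ ε → 0ℚ < ε → 0ℚ < ½ * ε
  half-pos ε 0<ε = subst (_< ½ * ε) (*-zeroʳ ½) (*-monoʳ-<-pos ½ 0<ε)

  half+half : ∀ ε → ½ * ε + ½ * ε ≡ ε
  half+half ε = trans (sym (*-distribʳ-+ ε ½ ½)) (*-identityˡ ε)

  ∣p∣-bound : ∀ {p q} → p ≤ q → - p ≤ q → ∣ p ∣ ≤ q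
  ∣p∣-bound {p} p≤q -p≤q with ∣p∣≡p∨∣p∣≡-p p
  ... | inj₁ eq rewrite eq = p≤q
  ... | inj₂ eq rewrite eq = -p≤q

  p≤∣p∣ : ∀ p → p ≤ ∣ p ∣
  p≤∣p∣ p with ≤-total 0ℚ p
  ... | inj₁ 0≤p = ≤-reflexive (sym (0≤p⇒∣p∣≡p 0≤p))
  ... | inj₂ p≤0 = ≤-trans p≤0 (0≤∣p∣ p)

  ∣p-q∣≡∣q-p∣ : ∀ p q → ∣ p - q ∣ ≡ ∣ q - p ∣
  ∣p-q∣≡∣q-p∣ p q = trans (sym (∣-p∣≡∣p∣ (p - q))) (cong ∣_∣ lem)
    where
    open +-*-Solver
    lem : - (p - q) ≡ q - p
    lem = solve 2 (λ p q → :- (p :- q) := q :- p) refl p q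

  ∣p∣-∣q∣≤∣p-q∣ : ∀ p q → ∣ p ∣ - ∣ q ∣ ≤ ∣ p - q ∣
  ∣p∣-∣q∣≤∣p-q∣ p q = begin
    ∣ p ∣ - ∣ q ∣                  ≡⟨ cong (λ r → ∣ r ∣ - ∣ q ∣) (lem₁ p q) ⟩
    ∣ (p - q) + q ∣ - ∣ q ∣        ≤⟨ +-monoˡ-≤ (- ∣ q ∣) (∣p+q∣≤∣p∣+∣q∣ (p - q) q) ⟩
    ∣ p - q ∣ + ∣ q ∣ - ∣ q ∣      ≡⟨ lem₂ ∣ p - q ∣ ∣ q ∣ ⟩
    ∣ p - q ∣                      ∎
    where
    open ≤-Reasoning
    open +-*-Solver
    lem₁ : ∀ p q → p ≡ (p - q) + q
    lem₁ = solve 2 (λ p q → p := (p :- q) :+ q) refl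
    lem₂ : ∀ a b → a + b - b ≡ a
    lem₂ = solve 2 (λ a b → a :+ b :- b := a) refl

  ∣∣p∣-∣q∣∣≤∣p-q∣ : ∀ p q → ∣ ∣ p ∣ - ∣ q ∣ ∣ ≤ ∣ p - q ∣
  ∣∣p∣-∣q∣∣≤∣p-q∣ p q = ∣p∣-bound (∣p∣-∣q∣≤∣p-q∣ p q)
    (subst₂ _≤_ (lem ∣ q ∣ ∣ p ∣) (∣p-q∣≡∣q-p∣ q p) (∣p∣-∣q∣≤∣p-q∣ q p))
    where
    open +-*-Solver
    lem : ∀ a b → a - b ≡ - (b - a)
    lem = solve 2 (λ a b → a :- b := :- (b :- a)) refl

  const-isCauchy : ∀ q → IsCauchy (λ _ → q)
  const-isCauchy q ε 0<ε =
    0 , λ _ _ _ _ → subst (λ r → ∣ r ∣ < ε) (sym (+-inverseʳ q)) 0<ε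

  sub-isCauchy : ∀ {s t} → IsCauchy s → IsCauchy t → IsCauchy (λ n → s n - t n)
  sub-isCauchy {s} {t} cs ct ε 0<ε with cs (½ * ε) (half-pos ε 0<ε) | ct (½ * ε) (half-pos ε 0<ε)
  ... | M , hs | N , ht = M ℕ.⊔ N , λ m n m≥ n≥ → begin-strict
    ∣ (s m - t m) - (s n - t n) ∣   ≡⟨ cong ∣_∣ (lem (s m) (t m) (s n) (t n)) ⟩
    ∣ (s m - s n) - (t m - t n) ∣   ≤⟨ ∣p-q∣≤∣p∣+∣q∣ (s m - s n) (t m - t n) ⟩
    ∣ s m - s n ∣ + ∣ t m - t n ∣   <⟨ +-mono-<
      (hs m n (ℕ.≤-trans (ℕ.m≤m⊔n M N) m≥) (ℕ.≤-trans (ℕ.m≤m⊔n M N) n≥))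
      (ht m n (ℕ.≤-trans (ℕ.m≤n⊔m M N) m≥) (ℕ.≤-trans (ℕ.m≤n⊔m M N) n≥)) ⟩
    ½ * ε + ½ * ε                   ≡⟨ half+half ε ⟩
    ε                               ∎
    where
    open ≤-Reasoning
    open +-*-Solver
    lem : ∀ a b c d → (a - b) - (c - d) ≡ (a - c) - (b - d)
    lem = solve 4 (λ a b c d → (a :- b) :- (c :- d) := (a :- c) :- (b :- d)) refl

  abs-isCauchy : ∀ {s} → IsCauchy s → IsCauchy (∣_∣ ∘ s)
  abs-isCauchy {s} cs ε 0<ε with cs ε 0<ε
  ... | N , h = N , λ m n m≥ n≥ →
    ≤-<-trans (∣∣p∣-∣q∣∣≤∣p-q∣ (s m) (s n)) (h m n m≥ n≥)

  scale-isCauchy : ∀ q {s} → IsCauchy s → IsCauchy (λ n → q * s n)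
  scale-isCauchy q {s} cs ε 0<ε = N , bound
    where
    c = ∣ q ∣ + 1ℚ
    instance
      c-pos : Positive c
      c-pos = nonNeg+pos⇒pos ∣ q ∣ {{∣-∣-nonNeg q}} 1ℚ
      c-nonZero : NonZero c
      c-nonZero = pos⇒nonZero c
      1/c-pos : Positive (1/ c)
      1/c-pos = 1/pos⇒pos c
    δ = 1/ c * ε
    0<δ : 0ℚ < δ
    0<δ = subst (_< δ) (*-zeroʳ (1/ c)) (*-monoʳ-<-pos (1/ c) 0<ε)
    N = proj₁ (cs δ 0<δ)
    open ≤-Reasoning
    open +-*-Solver
    bound : ∀ m n → N ℕ.≤ m → N ℕ.≤ n → ∣ q * s m - q * s n ∣ < ε
    bound m n m≥ n≥ = begin-strict
      ∣ q * s m - q * s n ∣   ≡⟨ cong ∣_∣ (solve 3 (λ q a b → q :* a :- q :* b := q :* (a :- b)) refl q (s m) (s n)) ⟩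
      ∣ q * d ∣               ≡⟨ ∣p*q∣≡∣p∣*∣q∣ q d ⟩
      ∣ q ∣ * ∣ d ∣           ≤⟨ *-monoʳ-≤-nonNeg ∣ d ∣ {{∣-∣-nonNeg d}}
                                   (subst (_≤ c) (+-identityʳ ∣ q ∣) (+-monoʳ-≤ ∣ q ∣ (<⇒≤ (positive⁻¹ 1ℚ)))) ⟩
      c * ∣ d ∣               <⟨ *-monoʳ-<-pos c (proj₂ (cs δ 0<δ) m n m≥ n≥) ⟩
      c * δ                   ≡⟨ sym (*-assoc c (1/ c) ε) ⟩
      (c * 1/ c) * ε          ≡⟨ cong (_* ε) (*-inverseʳ c) ⟩
      1ℚ * ε                  ≡⟨ *-identityˡ ε ⟩
      ε                       ∎
      where d = s m - s n

fromℚ : ℚ → ℝ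
fromℚ q = mkℝ (λ _ → q) (const-isCauchy q)

infixl 6 _-ℝ_
_-ℝ_ : ℝ → ℝ → ℝ
x -ℝ y = mkℝ (λ n → approx x n - approx y n) (sub-isCauchy {approx x} {approx y} (isCauchy x) (isCauchy y))

∣_∣ℝ : ℝ → ℝ
∣ x ∣ℝ = mkℝ (λ n → ∣ approx x n ∣) (abs-isCauchy {approx x} (isCauchy x))

infixl 7 _·_
_·_ : ℚ → ℝ → ℝ
q · x = mkℝ (λ n → q * approx x n) (scale-isCauchy q {approx x} (isCauchy x))

_⟶_ : (ℕ → ℝ) → ℝ → Set
s ⟶ L = ∀ ε → 0ℚ < ε → ∃[ N ] (∀ n → N ℕ.≤ n → ∣ s n -ℝ L ∣ℝ <ℝ fromℚ ε)

-- partialSum a n = a 0 + ⋯ + a (n - 1)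
partialSum : (ℕ → ℚ) → ℕ → ℚ
partialSum a zero    = 0ℚ
partialSum a (suc n) = partialSum a n + a n

HasSum : (ℕ → ℚ) → ℝ → Set
HasSum a L = (fromℚ ∘ partialSum a) ⟶ L

cauchySum : (a : ℕ → ℚ) → IsCauchy (partialSum a) → ℝ
cauchySum a = mkℝ (partialSum a)

cauchySum-hasSum : ∀ a c → HasSum a (cauchySum a c)
cauchySum-hasSum a c ε 0<ε with c (½ * ε) (half-pos ε 0<ε)
... | N , h = N , λ n n≥ → ½ * ε , half-pos ε 0<ε , N , λ m m≥ →
  subst (∣ partialSum a n - partialSum a m ∣ + ½ * ε <_) (half+half ε)
    (+-monoˡ-< (½ * ε) (h n m n≥ m≥))

fromℕ : ℕ → ℚ
fromℕ n = + n / 1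

infix 8 ⟨_⟩_
-- ⟨ x ⟩ n is the shifted factorial (x)ₙ, here for rational x.
⟨_⟩_ : ℚ → ℕ → ℚ
⟨ x ⟩ zero  = 1ℚ
⟨ x ⟩ suc n = ⟨ x ⟩ n * (x + fromℕ n)

⟨⟩-pos : ∀ x .{{_ : Positive x}} n → Positive (⟨ x ⟩ n)
⟨⟩-pos x zero    = _
⟨⟩-pos x (suc n) = pos*pos⇒pos (⟨ x ⟩ n) {{⟨⟩-pos x n}} (x + fromℕ n)
  {{pos+nonNeg⇒pos x (fromℕ n) {{normalize-nonNeg n 1}}}}

H⁽²⁾ : ℕ → ℚ
H⁽²⁾ n = partialSum (λ j → 1ℤ / (suc j ℕ.^ 2)) n

3/2 : ℚ
3/2 = + 3 / 2

¼ : ℚ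
¼ = + 1 / 4

2ℚ : ℚ
2ℚ = + 2 / 1

denom : ℕ → ℚ
denom k = ⟨ 3/2 ⟩ k * fromℕ (1 ℕ.+ 2 ℕ.* k)

denom-nonZero : ∀ k → NonZero (denom k)
denom-nonZero k = pos⇒nonZero (denom k) {{pos*pos⇒pos (⟨ 3/2 ⟩ k) {{⟨⟩-pos 3/2 k}}
  (fromℕ (1 ℕ.+ 2 ℕ.* k)) {{normalize-pos (1 ℕ.+ 2 ℕ.* k) 1}}}}

β4-term : ℕ → ℚ
β4-term k = (-1ℤ ℤ.^ k) / ((1 ℕ.+ 2 ℕ.* k) ℕ.^ 4)

private
  -1^k : ∀ k → -1ℤ ℤ.^ k ≡ 1ℤ ⊎ -1ℤ ℤ.^ k ≡ -1ℤ
  -1^k zero = inj₁ refl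
  -1^k (suc k) with -1^k k
  ... | inj₁ eq = inj₂ (cong (-1ℤ ℤ.*_) eq)
  ... | inj₂ eq = inj₁ (cong (-1ℤ ℤ.*_) eq)

  ∣±1/d∣ : ∀ {i} d → i ≡ 1ℤ ⊎ i ≡ -1ℤ → ∣ i / suc d ∣ ≡ 1ℤ / suc d
  ∣±1/d∣ d (inj₁ refl) = 0≤p⇒∣p∣≡p (nonNegative⁻¹ (1ℤ / suc d) {{normalize-nonNeg 1 (suc d)}})
  ∣±1/d∣ d (inj₂ refl) = trans (∣-p∣≡∣p∣ (1ℤ / suc d)) (∣±1/d∣ d (inj₁ refl))

  tail : ℕ → ℚ
  tail n = + 2 / suc n

  toℚᵘ-/ : ∀ i d → toℚᵘ (i / suc d) ℚᵘ.≃ mkℚᵘ i d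
  toℚᵘ-/ i d = toℚᵘ-fromℚᵘ (mkℚᵘ i d)

  quartic-bound : ∀ n → suc n ℕ.* suc (suc n) ℕ.≤ 2 ℕ.* (1 ℕ.+ 2 ℕ.* n) ℕ.^ 4
  quartic-bound n = begin
    suc n ℕ.* suc (suc n)                                          ≤⟨ ℕ.m≤m+n _ _ ⟩
    suc n ℕ.* suc (suc n) ℕ.+ (5 ℕ.* n ℕ.+ 7 ℕ.* (n ℕ.* n))        ≡⟨ lem n ⟩
    2 ℕ.* ((1 ℕ.+ 2 ℕ.* n) ℕ.* ((1 ℕ.+ 2 ℕ.* n) ℕ.* 1))            ≤⟨ ℕ.*-monoʳ-≤ 2 (ℕ.^-monoʳ-≤ (1 ℕ.+ 2 ℕ.* n) {2} {4} (ℕ.s≤s (ℕ.s≤s ℕ.z≤n))) ⟩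
    2 ℕ.* (1 ℕ.+ 2 ℕ.* n) ℕ.^ 4                                    ∎
    where
    open ℕ.≤-Reasoning
    lem : ∀ n → suc n ℕ.* suc (suc n) ℕ.+ (5 ℕ.* n ℕ.+ 7 ℕ.* (n ℕ.* n))
              ≡ 2 ℕ.* ((1 ℕ.+ 2 ℕ.* n) ℕ.* ((1 ℕ.+ 2 ℕ.* n) ℕ.* 1))
    lem = ℕ-Solver.solve-∀

  step-cross : ∀ n d → suc n ℕ.* suc (suc n) ℕ.≤ 2 ℕ.* suc d →
    (1 ℕ.* suc (suc n) ℕ.+ 2 ℕ.* suc d) ℕ.* suc n ℕ.≤ 2 ℕ.* (suc d ℕ.* suc (suc n))
  step-cross n d le = begin
    (1 ℕ.* suc (suc n) ℕ.+ 2 ℕ.* suc d) ℕ.* suc n       ≡⟨ lem₁ n (suc d) ⟩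
    suc n ℕ.* suc (suc n) ℕ.+ 2 ℕ.* suc d ℕ.* suc n     ≤⟨ ℕ.+-monoˡ-≤ _ le ⟩
    2 ℕ.* suc d ℕ.+ 2 ℕ.* suc d ℕ.* suc n               ≡⟨ lem₂ n (suc d) ⟩
    2 ℕ.* (suc d ℕ.* suc (suc n))                       ∎
    where
    open ℕ.≤-Reasoning
    lem₁ : ∀ n D → (1 ℕ.* suc (suc n) ℕ.+ 2 ℕ.* D) ℕ.* suc n ≡ suc n ℕ.* suc (suc n) ℕ.+ 2 ℕ.* D ℕ.* suc n
    lem₁ = ℕ-Solver.solve-∀
    lem₂ : ∀ n D → 2 ℕ.* D ℕ.+ 2 ℕ.* D ℕ.* suc n ≡ 2 ℕ.* (D ℕ.* suc (suc n))
    lem₂ = ℕ-Solver.solve-∀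

  step-frac : ∀ n d → suc n ℕ.* suc (suc n) ℕ.≤ 2 ℕ.* suc d →
    1ℤ / suc d + tail (suc n) ≤ tail n
  step-frac n d le = toℚᵘ-cancel-≤ (begin
    toℚᵘ (1ℤ / suc d + tail (suc n))                 ≃⟨ toℚᵘ-homo-+ (1ℤ / suc d) (tail (suc n)) ⟩
    toℚᵘ (1ℤ / suc d) ℚᵘ.+ toℚᵘ (tail (suc n))       ≃⟨ ℚᵘ.+-cong (toℚᵘ-/ 1ℤ d) (toℚᵘ-/ (+ 2) (suc n)) ⟩
    mkℚᵘ 1ℤ d ℚᵘ.+ mkℚᵘ (+ 2) (suc n)                ≤⟨ ℚᵘ.*≤* (+≤+ (step-cross n d le)) ⟩
    mkℚᵘ (+ 2) n                                     ≃⟨ ℚᵘ.≃-sym (toℚᵘ-/ (+ 2) n) ⟩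
    toℚᵘ (tail n)                                    ∎)
    where open ℚᵘ.≤-Reasoning

  β4-step : ∀ n → ∣ β4-term n ∣ + tail (suc n) ≤ tail n
  β4-step n = subst (λ r → r + tail (suc n) ≤ tail n) (sym (∣±1/d∣ _ (-1^k n)))
    (step-frac n _ (quartic-bound n))

  tail-sum : ∀ m d → ∣ partialSum β4-term (d ℕ.+ m) - partialSum β4-term m ∣ + tail (d ℕ.+ m) ≤ tail m
  tail-sum m zero = ≤-reflexive (trans
    (cong (λ r → ∣ r ∣ + tail m) (+-inverseʳ (partialSum β4-term m))) (+-identityˡ (tail m)))
  tail-sum m (suc d) = begin
    ∣ S + b - T ∣ + t′           ≡⟨ cong (λ r → ∣ r ∣ + t′) (lem S b T) ⟩
    ∣ S - T + b ∣ + t′           ≤⟨ +-monoˡ-≤ t′ (∣p+q∣≤∣p∣+∣q∣ (S - T) b) ⟩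
    ∣ S - T ∣ + ∣ b ∣ + t′       ≡⟨ +-assoc ∣ S - T ∣ ∣ b ∣ t′ ⟩
    ∣ S - T ∣ + (∣ b ∣ + t′)     ≤⟨ +-monoʳ-≤ ∣ S - T ∣ (β4-step (d ℕ.+ m)) ⟩
    ∣ S - T ∣ + tail (d ℕ.+ m)   ≤⟨ tail-sum m d ⟩
    tail m                       ∎
    where
    open ≤-Reasoning
    open +-*-Solver
    S = partialSum β4-term (d ℕ.+ m)
    T = partialSum β4-term m
    b = β4-term (d ℕ.+ m)
    t′ = tail (suc (d ℕ.+ m))
    lem : ∀ s b t → s + b - t ≡ s - t + b
    lem = solve 3 (λ s b t → s :+ b :- t := s :- t :+ b) refl

  tail-bound : ∀ N n → N ℕ.≤ n → ∣ partialSum β4-term n - partialSum β4-term N ∣ ≤ tail N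
  tail-bound N n N≤n = subst (λ k → ∣ partialSum β4-term k - partialSum β4-term N ∣ ≤ tail N)
    (ℕ.m∸n+n≡m N≤n)
    (≤-trans (subst (_≤ D + tail (n ℕ.∸ N ℕ.+ N)) (+-identityʳ D)
                (+-monoʳ-≤ D (nonNegative⁻¹ (tail (n ℕ.∸ N ℕ.+ N)) {{normalize-nonNeg 2 (suc (n ℕ.∸ N ℕ.+ N))}})))
             (tail-sum N (n ℕ.∸ N)))
    where D = ∣ partialSum β4-term (n ℕ.∸ N ℕ.+ N) - partialSum β4-term N ∣

  tail-small : ∀ ε → 0ℚ < ε → ∃[ N ] tail N < ε
  tail-small (mkℚ (+ zero) q _)    (*<* (+<+ ()))
  tail-small (mkℚ -[1+ _ ] q _)    (*<* ())
  tail-small (mkℚ +[1+ p ] q c) _ = 2 ℕ.* suc q , toℚᵘ-cancel-< (ℚᵘ.<-respˡ-≃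
    (ℚᵘ.≃-sym (toℚᵘ-/ (+ 2) (2 ℕ.* suc q)))
    (ℚᵘ.*<* (+<+ (ℕ.m≤m+n (suc (2 ℕ.* suc q)) (p ℕ.* suc (2 ℕ.* suc q))))))

β4-isCauchy : IsCauchy (partialSum β4-term)
β4-isCauchy ε 0<ε with tail-small (½ * ε) (half-pos ε 0<ε)
... | N , tN<ε/2 = N , λ m n m≥ n≥ → begin-strict
  ∣ S m - S n ∣                    ≡⟨ cong ∣_∣ (lem (S m) (S n) (S N)) ⟩
  ∣ (S m - S N) - (S n - S N) ∣    ≤⟨ ∣p-q∣≤∣p∣+∣q∣ (S m - S N) (S n - S N) ⟩
  ∣ S m - S N ∣ + ∣ S n - S N ∣    ≤⟨ +-mono-≤ (tail-bound N m m≥) (tail-bound N n n≥) ⟩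
  tail N + tail N                  <⟨ +-mono-< tN<ε/2 tN<ε/2 ⟩
  ½ * ε + ½ * ε                    ≡⟨ half+half ε ⟩
  ε                                ∎
  where
  open ≤-Reasoning
  open +-*-Solver
  S = partialSum β4-term
  lem : ∀ a b c → a - b ≡ (a - c) - (b - c)
  lem = solve 3 (λ a b c → a :- b := (a :- c) :- (b :- c)) refl

β4 : ℝ
β4 = cauchySum β4-term β4-isCauchy

{-# OPTIONS --safe #-}
module Submission where

-- The bracket in the k-th term is O⁽²⁾ (k + 1) = Σ_{j ≤ k} 1/(2j+1)², the x²-coefficient of
-- ∏_{j ≤ k} (1 − x²/(2j+1)²)⁻¹.  Expanding that product in partial fractions turns the k-th term into
-- q k · Σₘ (−1)ᵐ u k m / (2m+1)³.  For each m the series in k then telescopes by a WZ argument: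
-- ½ (2m+1) q k · u k m = R k m − R (k+1) m with R k m = q k · g k m and R 0 m = 1.  Hence the n-th partial
-- sum is 2 Σₘ (−1)ᵐ (1 − R n m) / (2m+1)⁴, and since ∣R n m∣ ≤ (2m+1) q n the error is at most
-- 2 q n · Σₘ 1/(2m+1)³ ≤ 4 q n, where q n = C(2n,n)/4ⁿ tends to 0.

open import Defs
open import Data.Nat as ℕ using (ℕ; zero; suc)
import Data.Nat.Properties as ℕ
import Data.Nat.Tactic.RingSolver as ℕ-Solver
open import Data.Integer as ℤ using (-1ℤ; 1ℤ)
import Data.Integer.Properties as ℤ
open import Data.Product using (_,_; proj₁; proj₂; ∃-syntax)
open import Data.Rational using (ℚ; 0ℚ; 1ℚ; ½; _+_; _*_; _-_; -_; _÷_; _/_; 1/_; ∣_∣; _≤_; _<_; *<*; mkℚ; NonNegative; Positive; nonNegative; toℚᵘ)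
open import Data.Rational.Properties
open import Data.Rational.Solver using (module +-*-Solver)
open import Data.Rational.Unnormalised as ℚᵘ using (mkℚᵘ)
import Data.Rational.Unnormalised.Properties as ℚᵘ
open import Data.Sum using (inj₁; inj₂)
open import Relation.Binary.PropositionalEquality
open +-*-Solver

-- Naturals and unit fractions inside the rationals.

toℚᵘ-/ : ∀ i d → toℚᵘ (i / suc d) ℚᵘ.≃ mkℚᵘ i d
toℚᵘ-/ i d = toℚᵘ-fromℚᵘ (mkℚᵘ i d)

fromℕ-+ : ∀ m n → fromℕ (m ℕ.+ n) ≡ fromℕ m + fromℕ n
fromℕ-+ m n = toℚᵘ-injective (begin
  toℚᵘ (fromℕ (m ℕ.+ n))                 ≈⟨ toℚᵘ-/ (ℤ.+ (m ℕ.+ n)) 0 ⟩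
  mkℚᵘ (ℤ.+ (m ℕ.+ n)) 0                   ≈⟨ ℚᵘ.*≡* (cong (ℤ._* 1ℤ) (sym (cong₂ ℤ._+_ (ℤ.*-identityʳ (ℤ.+ m)) (ℤ.*-identityʳ (ℤ.+ n))))) ⟩
  mkℚᵘ (ℤ.+ m) 0 ℚᵘ.+ mkℚᵘ (ℤ.+ n) 0         ≈⟨ ℚᵘ.+-cong (toℚᵘ-/ (ℤ.+ m) 0) (toℚᵘ-/ (ℤ.+ n) 0) ⟨
  toℚᵘ (fromℕ m) ℚᵘ.+ toℚᵘ (fromℕ n)     ≈⟨ toℚᵘ-homo-+ (fromℕ m) (fromℕ n) ⟨
  toℚᵘ (fromℕ m + fromℕ n)               ∎)
  where open ℚᵘ.≃-Reasoning

fromℕ-* : ∀ m n → fromℕ (m ℕ.* n) ≡ fromℕ m * fromℕ n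
fromℕ-* zero    n = sym (*-zeroˡ (fromℕ n))
fromℕ-* (suc m) n = trans (fromℕ-+ n (m ℕ.* n)) (trans (cong (λ t → fromℕ n + t) (fromℕ-* m n))
  (trans (solve 2 (λ a b → b :+ a :* b := (con 1ℚ :+ a) :* b) refl (fromℕ m) (fromℕ n))
         (cong (_* fromℕ n) (sym (fromℕ-+ 1 m)))))

/-split : ∀ i d → i / suc d ≡ (i / 1) * (1ℤ / suc d)
/-split i d = toℚᵘ-injective (begin
  toℚᵘ (i / suc d)                          ≈⟨ toℚᵘ-/ i d ⟩
  mkℚᵘ i d                                  ≈⟨ ℚᵘ.*≡* (cong₂ ℤ._*_ (sym (ℤ.*-identityʳ i)) (cong (λ e → ℤ.+ suc e) (ℕ.+-identityʳ d))) ⟩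
  mkℚᵘ i 0 ℚᵘ.* mkℚᵘ 1ℤ d                   ≈⟨ ℚᵘ.*-cong (toℚᵘ-/ i 0) (toℚᵘ-/ 1ℤ d) ⟨
  toℚᵘ (i / 1) ℚᵘ.* toℚᵘ (1ℤ / suc d)       ≈⟨ toℚᵘ-homo-* (i / 1) (1ℤ / suc d) ⟨
  toℚᵘ ((i / 1) * (1ℤ / suc d))             ∎)
  where open ℚᵘ.≃-Reasoning

recip : ℕ → ℚ
recip d = 1ℤ / suc d

recip-inverse : ∀ d → recip d * fromℕ (suc d) ≡ 1ℚ
recip-inverse d = toℚᵘ-injective (begin
  toℚᵘ (recip d * fromℕ (suc d))               ≈⟨ toℚᵘ-homo-* (recip d) (fromℕ (suc d)) ⟩
  toℚᵘ (recip d) ℚᵘ.* toℚᵘ (fromℕ (suc d))     ≈⟨ ℚᵘ.*-cong (toℚᵘ-/ 1ℤ d) (toℚᵘ-/ (ℤ.+ suc d) 0) ⟩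
  mkℚᵘ 1ℤ d ℚᵘ.* mkℚᵘ (ℤ.+ suc d) 0              ≈⟨ ℚᵘ.*≡* (cong (λ e → ℤ.+ suc e) (lem d)) ⟩
  mkℚᵘ 1ℤ 0                                    ∎)
  where
  open ℚᵘ.≃-Reasoning
  lem : ∀ d → (d ℕ.+ 0) ℕ.* 1 ≡ d ℕ.* 1 ℕ.+ 0
  lem = ℕ-Solver.solve-∀


fromℕ-suc : ∀ n → fromℕ (suc n) ≡ 1ℚ + fromℕ n
fromℕ-suc = fromℕ-+ 1

-- Deriving equations from hypotheses with the ring solver, and odd numbers.

-- Reduces a ≡ b to a ring identity expressing a - b = c * (l - r); nesting it gives linear combinations of hypotheses.
lin : ∀ {a b l r} c → l ≡ r → a + c * r ≡ b + c * l → a ≡ b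
lin {a} {b} {l} c refl eq = trans (add-sub a) (trans (cong (_- c * l) eq) (sym (add-sub b)))
  where
  add-sub : ∀ d → d ≡ d + c * l - c * l
  add-sub d = solve 2 (λ d e → d := d :+ e :- e) refl d (c * l)

-- The inverse enters as an explicit witness `i`, which makes cancellation a polynomial consequence
-- of the two equations.
*-cancelʳ-inverse : ∀ {a b} i r → i * r ≡ 1ℚ → a * r ≡ b * r → a ≡ b
*-cancelʳ-inverse {a} {b} i r ir≡1 eq = lin i eq (lin (- (a - b)) ir≡1
  (solve 4 (λ a b i r → a :+ i :* (b :* r) :+ (:- (a :- b)) :* con 1ℚ
                     := b :+ i :* (a :* r) :+ (:- (a :- b)) :* (i :* r)) refl a b i r))

-- Kept as a polynomial in `fromℕ m` so that the ring solver can expand it.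
odd : ℕ → ℚ
odd m = 2ℚ * fromℕ m + 1ℚ

odd-fromℕ : ∀ m → fromℕ (1 ℕ.+ 2 ℕ.* m) ≡ odd m
odd-fromℕ m = trans (fromℕ-suc (2 ℕ.* m)) (trans (cong (1ℚ +_) (fromℕ-* 2 m)) (+-comm 1ℚ (2ℚ * fromℕ m)))

1/odd : ℕ → ℚ
1/odd m = recip (2 ℕ.* m)

1/odd-inverse : ∀ m → 1/odd m * odd m ≡ 1ℚ
1/odd-inverse m = trans (cong (1/odd m *_) (sym (odd-fromℕ m))) (recip-inverse (2 ℕ.* m))

recip-suc-inverse : ∀ n → recip n * (1ℚ + fromℕ n) ≡ 1ℚ
recip-suc-inverse n = trans (cong (recip n *_) (sym (fromℕ-suc n))) (recip-inverse n)

recip-+-inverse : ∀ n m → recip (suc (n ℕ.+ m)) * (fromℕ n + fromℕ m + 2ℚ) ≡ 1ℚ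
recip-+-inverse n m = trans (cong (recip (suc (n ℕ.+ m)) *_) eq) (recip-inverse (suc (n ℕ.+ m)))
  where
  eq : fromℕ n + fromℕ m + 2ℚ ≡ fromℕ (suc (suc (n ℕ.+ m)))
  eq = sym (trans (fromℕ-+ 2 (n ℕ.+ m)) (trans (+-comm 2ℚ (fromℕ (n ℕ.+ m))) (cong (_+ 2ℚ) (fromℕ-+ n m))))

-- The kernel `u` and its recurrences.

-- u n m = n!² / ((n-m)! (n+m+1)!), read as 0 for m > n.
u : ℕ → ℕ → ℚ
u n zero    = recip n
u n (suc m) = u n m * (fromℕ n - fromℕ m) * recip (suc (n ℕ.+ m))

u-suc : ∀ n m → u n (suc m) * (fromℕ n + fromℕ m + 2ℚ) ≡ u n m * (fromℕ n - fromℕ m)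
u-suc n m = lin (u n m * (fromℕ n - fromℕ m)) (recip-+-inverse n m)
  (solve 4 (λ u x y j → u :* (x :- y) :* j :* (x :+ y :+ con 2ℚ) :+ u :* (x :- y) :* con 1ℚ
                     := u :* (x :- y) :+ u :* (x :- y) :* (j :* (x :+ y :+ con 2ℚ))) refl
     (u n m) (fromℕ n) (fromℕ m) (recip (suc (n ℕ.+ m))))

-- The step from `m = n` to `n + 1` carries the factor n - n, and every later value is a multiple of
-- that zero.
u-vanish : ∀ {n m} → n ℕ.< m → u n m ≡ 0ℚ
u-vanish {n} {suc m} (ℕ.s≤s n≤m) with ℕ.m≤n⇒m<n∨m≡n n≤m
... | inj₁ n<m  = trans (cong (λ v → v * (fromℕ n - fromℕ m) * j) (u-vanish n<m))
                        (solve 2 (λ d j → con 0ℚ :* d :* j := con 0ℚ) refl (fromℕ n - fromℕ m) j)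
  where j = recip (suc (n ℕ.+ m))
... | inj₂ refl = solve 3 (λ v x j → v :* (x :- x) :* j := con 0ℚ) refl (u n n) (fromℕ n) (recip (suc (n ℕ.+ n)))

-- The quotient of the two factorial expressions, cross-multiplied because n + 1 - m vanishes at
-- `m = n + 1`.
u-shift : ∀ n m → u (suc n) m * ((1ℚ + fromℕ n - fromℕ m) * (fromℕ n + fromℕ m + 2ℚ))
                ≡ (1ℚ + fromℕ n) * (1ℚ + fromℕ n) * u n m
u-shift n zero = alg (fromℕ n) (recip n) (recip (suc n)) (fromℕ-suc n) (recip-suc-inverse n) (recip-suc-inverse (suc n))
  where
  -- As in the later `alg`s, rationals become variables: equations such as `X ≡ 1ℚ + x` are matched
  -- with `refl`, and the goal is a combination of the remaining hypotheses.
  alg : ∀ x {X} i i′ → X ≡ 1ℚ + x → i * (1ℚ + x) ≡ 1ℚ → i′ * (1ℚ + X) ≡ 1ℚ →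
    i′ * ((1ℚ + x - 0ℚ) * (x + 0ℚ + 2ℚ)) ≡ (1ℚ + x) * (1ℚ + x) * i
  alg x i i′ refl hi hi′ = lin (1ℚ + x) hi′ (lin (- (1ℚ + x)) hi
    (solve 3 (λ x i i′ → let X = con 1ℚ :+ x in
      i′ :* ((X :- con 0ℚ) :* (x :+ con 0ℚ :+ con 2ℚ))
        :+ X :* con 1ℚ :+ (:- X) :* con 1ℚ
      := X :* X :* i
        :+ X :* (i′ :* (con 1ℚ :+ X)) :+ (:- X) :* (i :* X))
      refl x i i′))
-- Multiplying by n + m + 2 lets `u-suc` eliminate `u n (suc m)`.
u-shift n (suc m) = *-cancelʳ-inverse (recip (suc (n ℕ.+ m))) (fromℕ n + fromℕ m + 2ℚ) (recip-+-inverse n m)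
  (alg (fromℕ n) (fromℕ m) (u n m) (u (suc n) m) (u n (suc m)) (u (suc n) (suc m)) (fromℕ-suc n) (fromℕ-suc m) (u-suc n m) (u-suc (suc n) m) (u-shift n m))
  where
  alg : ∀ x y {X Y} U V U₊ V₊ → X ≡ 1ℚ + x → Y ≡ 1ℚ + y →
    U₊ * (x + y + 2ℚ) ≡ U * (x - y) → V₊ * (X + y + 2ℚ) ≡ V * (X - y) →
    V * ((1ℚ + x - y) * (x + y + 2ℚ)) ≡ (1ℚ + x) * (1ℚ + x) * U →
    V₊ * ((1ℚ + x - Y) * (x + Y + 2ℚ)) * (x + y + 2ℚ) ≡ (1ℚ + x) * (1ℚ + x) * U₊ * (x + y + 2ℚ)
  alg x y U V U₊ V₊ refl refl hU hV ih =
    lin (- ((1ℚ + x) * (1ℚ + x))) hU (lin ((x - y) * (x + y + 2ℚ)) hV (lin (x - y) ih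
    (solve 6 (λ x y U V U₊ V₊ → let s = x :+ y :+ con 2ℚ; X = con 1ℚ :+ x; Y = con 1ℚ :+ y in
      V₊ :* ((X :- Y) :* (x :+ Y :+ con 2ℚ)) :* s
        :+ (:- (X :* X)) :* (U :* (x :- y)) :+ (x :- y) :* s :* (V :* (X :- y)) :+ (x :- y) :* (X :* X :* U)
      := X :* X :* U₊ :* s
        :+ (:- (X :* X)) :* (U₊ :* s) :+ (x :- y) :* s :* (V₊ :* (X :+ y :+ con 2ℚ)) :+ (x :- y) :* (V :* ((X :- y) :* s)))
      refl x y U V U₊ V₊)))

-- The antidifference `g` and its recurrence in n.

-- The increment in m is the WZ mate of u.
g : ℕ → ℕ → ℚ
g n zero    = 1ℚ
g n (suc m) = g n m + 2ℚ * (u n m * (fromℕ n - fromℕ m))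

-- Multiplied by `q n` and divided by 2(n + 1), this is R n m - R (n+1) m = ½ (2m+1) q n · u n m,
-- since q (n+1) = q n · (2n+1)/(2(n+1)). In the induction on m, `u-suc` and `u-shift` match the
-- increments of the two sides.
g-step : ∀ n m → 2ℚ * (1ℚ + fromℕ n) * g n m - odd n * g (suc n) m ≡ odd m * ((1ℚ + fromℕ n) * u n m)
g-step n zero = lin (- 1ℚ) (recip-suc-inverse n)
  (solve 2 (λ x i → let X = con 1ℚ :+ x in
    con 2ℚ :* X :* con 1ℚ :- (con 2ℚ :* x :+ con 1ℚ) :* con 1ℚ :+ con (- 1ℚ) :* con 1ℚ
    := (con 2ℚ :* con 0ℚ :+ con 1ℚ) :* (X :* i) :+ con (- 1ℚ) :* (i :* X))
    refl (fromℕ n) (recip n))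
g-step n (suc m) = *-cancelʳ-inverse (recip (suc (n ℕ.+ m))) (fromℕ n + fromℕ m + 2ℚ) (recip-+-inverse n m)
  (alg (fromℕ n) (fromℕ m) (u n m) (u (suc n) m) (u n (suc m)) (g n m) (g (suc n) m)
    (fromℕ-suc n) (fromℕ-suc m) (u-suc n m) (u-shift n m) (g-step n m))
  where
  alg : ∀ x y {X Y} U V U₊ g g′ → X ≡ 1ℚ + x → Y ≡ 1ℚ + y →
    U₊ * (x + y + 2ℚ) ≡ U * (x - y) →
    V * ((1ℚ + x - y) * (x + y + 2ℚ)) ≡ (1ℚ + x) * (1ℚ + x) * U →
    2ℚ * (1ℚ + x) * g - (2ℚ * x + 1ℚ) * g′ ≡ (2ℚ * y + 1ℚ) * ((1ℚ + x) * U) →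
    (2ℚ * (1ℚ + x) * (g + 2ℚ * (U * (x - y))) - (2ℚ * x + 1ℚ) * (g′ + 2ℚ * (V * (X - y)))) * (x + y + 2ℚ)
      ≡ (2ℚ * Y + 1ℚ) * ((1ℚ + x) * U₊) * (x + y + 2ℚ)
  alg x y U V U₊ g g′ refl refl hU hV ih =
    lin (x + y + 2ℚ) ih (lin (- (2ℚ * (2ℚ * x + 1ℚ))) hV (lin (- ((2ℚ * (1ℚ + y) + 1ℚ) * (1ℚ + x))) hU
    (solve 7 (λ x y U V U₊ g g′ → let s = x :+ y :+ con 2ℚ; X = con 1ℚ :+ x; Y = con 1ℚ :+ y; o = λ z → con 2ℚ :* z :+ con 1ℚ in
      (con 2ℚ :* X :* (g :+ con 2ℚ :* (U :* (x :- y))) :- o x :* (g′ :+ con 2ℚ :* (V :* (X :- y)))) :* s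
        :+ s :* (o y :* (X :* U))
        :+ (:- (con 2ℚ :* o x)) :* (X :* X :* U)
        :+ (:- (o Y :* X)) :* (U :* (x :- y))
      := o Y :* (X :* U₊) :* s
        :+ s :* (con 2ℚ :* X :* g :- o x :* g′)
        :+ (:- (con 2ℚ :* o x)) :* (V :* ((X :- y) :* s))
        :+ (:- (o Y :* X)) :* (U₊ :* s))
      refl x y U V U₊ g g′)))

-- Gives R 0 m = 1, where the telescoping starts: the first increment has the factor 0 - 0, and the
-- later ones contain a vanishing `u`.
g-zero : ∀ m → g 0 m ≡ 1ℚ
g-zero zero          = refl
g-zero (suc zero)    = refl
g-zero (suc (suc m)) = trans
  (cong₂ (λ a b → a + 2ℚ * (b * (0ℚ - fromℕ (suc m)))) (g-zero (suc m)) (u-vanish {0} {suc m} (ℕ.s≤s ℕ.z≤n)))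
  (solve 1 (λ y → con 1ℚ :+ con 2ℚ :* (con 0ℚ :* (con 0ℚ :- y)) := con 1ℚ) refl (fromℕ (suc m)))

-- Alternating sums of `u` weighted by powers of 2m + 1.

partialSum-linear : ∀ a b c {f g h} → (∀ m → a * f m ≡ b * g m + c * h m) →
  ∀ M → a * partialSum f M ≡ b * partialSum g M + c * partialSum h M
partialSum-linear a b c eq zero = solve 3 (λ a b c → a :* con 0ℚ := b :* con 0ℚ :+ c :* con 0ℚ) refl a b c
partialSum-linear a b c {f} {g} {h} eq (suc M) = lin 1ℚ (eq M) (lin 1ℚ (partialSum-linear a b c eq M)
  (solve 9 (λ a b c f g h F G H →
    a :* (F :+ f) :+ con 1ℚ :* (b :* g :+ c :* h) :+ con 1ℚ :* (b :* G :+ c :* H)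
    := b :* (G :+ g) :+ c :* (H :+ h) :+ con 1ℚ :* (a :* f) :+ con 1ℚ :* (a :* F))
    refl a b c (f M) (g M) (h M) (partialSum f M) (partialSum g M) (partialSum h M)))

sgn : ℕ → ℚ
sgn k = (-1ℤ ℤ.^ k) / 1

sgn-suc : ∀ k → sgn (suc k) ≡ - sgn k
sgn-suc k = toℚᵘ-injective (begin
  toℚᵘ (sgn (suc k))             ≈⟨ toℚᵘ-/ (-1ℤ ℤ.^ suc k) 0 ⟩
  mkℚᵘ (-1ℤ ℤ.^ suc k) 0         ≈⟨ ℚᵘ.*≡* (cong (ℤ._* 1ℤ) (ℤ.-1*i≡-i (-1ℤ ℤ.^ k))) ⟩
  ℚᵘ.- mkℚᵘ (-1ℤ ℤ.^ k) 0        ≈⟨ ℚᵘ.-‿cong (toℚᵘ-/ (-1ℤ ℤ.^ k) 0) ⟨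
  ℚᵘ.- toℚᵘ (sgn k)              ≈⟨ toℚᵘ-homo‿- (sgn k) ⟨
  toℚᵘ (- sgn k)                 ∎)
  where open ℚᵘ.≃-Reasoning

-- The cutoff is independent of n: terms with m > n vanish, so sums for different n can share one
-- cutoff.
σ : (ℕ → ℚ) → ℕ → ℕ → ℚ
σ w n = partialSum (λ m → w m * u n m)

σ-zero : ∀ w M → σ w 0 (suc M) ≡ w 0
σ-zero w zero    = solve 1 (λ a → con 0ℚ :+ a :* con 1ℚ := a) refl (w 0)
σ-zero w (suc M) = trans (cong₂ (λ a b → a + w (suc M) * b) (σ-zero w M) (u-vanish {0} {suc M} (ℕ.s≤s ℕ.z≤n)))
  (solve 2 (λ a b → a :+ b :* con 0ℚ := a) refl (w 0) (w (suc M)))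

-- Termwise this is (2n+3)² = 4(n+1-m)(n+m+2) + (2m+1)² combined with `u-shift`; the last summand
-- raises the weight by (2m+1)².
σ-shift : ∀ w w′ → (∀ m → w′ m ≡ w m * (odd m * odd m)) → ∀ n M →
  odd (suc n) * odd (suc n) * σ w (suc n) M
    ≡ 2ℚ * 2ℚ * ((1ℚ + fromℕ n) * (1ℚ + fromℕ n)) * σ w n M + 1ℚ * σ w′ (suc n) M
σ-shift w w′ eq n = partialSum-linear (odd (suc n) * odd (suc n)) (2ℚ * 2ℚ * ((1ℚ + fromℕ n) * (1ℚ + fromℕ n))) 1ℚ
  λ m → alg (fromℕ n) (fromℕ m) (u n m) (u (suc n) m) (w m) (w′ m) (fromℕ-suc n) (eq m) (u-shift n m)
  where
  alg : ∀ x y {X} U V w w′ → X ≡ 1ℚ + x → w′ ≡ w * ((2ℚ * y + 1ℚ) * (2ℚ * y + 1ℚ)) →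
    V * ((1ℚ + x - y) * (x + y + 2ℚ)) ≡ (1ℚ + x) * (1ℚ + x) * U →
    (2ℚ * X + 1ℚ) * (2ℚ * X + 1ℚ) * (w * V) ≡ 2ℚ * 2ℚ * ((1ℚ + x) * (1ℚ + x)) * (w * U) + 1ℚ * (w′ * V)
  alg x y U V w w′ refl refl hV = lin (2ℚ * 2ℚ * w) hV
    (solve 5 (λ x y U V w → let s = x :+ y :+ con 2ℚ; X = con 1ℚ :+ x; o = λ z → con 2ℚ :* z :+ con 1ℚ in
      o X :* o X :* (w :* V) :+ con 2ℚ :* con 2ℚ :* w :* (X :* X :* U)
      := con 2ℚ :* con 2ℚ :* (X :* X) :* (w :* U) :+ con 1ℚ :* (w :* (o y :* o y) :* V)
        :+ con 2ℚ :* con 2ℚ :* w :* (V :* ((X :- y) :* s)))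
      refl x y U V w)

-- Subscripts are the exponents of 2m + 1.
w₁ w₋₁ w₋₃ w₋₄ : ℕ → ℚ
w₁  m = sgn m * odd m
w₋₁ m = sgn m * 1/odd m
w₋₃ m = sgn m * (1/odd m * 1/odd m * 1/odd m)
w₋₄ m = w₋₃ m * 1/odd m

w₁-from-w₋₁ : ∀ m → w₁ m ≡ w₋₁ m * (odd m * odd m)
w₁-from-w₋₁ m = lin (- (sgn m * odd m)) (1/odd-inverse m)
  (solve 3 (λ s θ o → s :* o :+ (:- (s :* o)) :* con 1ℚ := s :* θ :* (o :* o) :+ (:- (s :* o)) :* (θ :* o))
    refl (sgn m) (1/odd m) (odd m))

w₋₁-from-w₋₃ : ∀ m → w₋₁ m ≡ w₋₃ m * (odd m * odd m)
w₋₁-from-w₋₃ m = lin (- (sgn m * 1/odd m * (1/odd m * odd m + 1ℚ))) (1/odd-inverse m)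
  (solve 3 (λ s θ o → s :* θ :+ (:- (s :* θ :* (θ :* o :+ con 1ℚ))) :* con 1ℚ
    := s :* (θ :* θ :* θ) :* (o :* o) :+ (:- (s :* θ :* (θ :* o :+ con 1ℚ))) :* (θ :* o))
    refl (sgn m) (1/odd m) (odd m))

-- Gosper's antidifference of the alternating sum.
σ₁-closed : ∀ n M → fromℕ n * σ w₁ n M ≡ - (sgn M * (fromℕ M * ((fromℕ n + fromℕ M + 1ℚ) * u n M)))
σ₁-closed n zero = solve 2 (λ x i → x :* con 0ℚ := :- (con 1ℚ :* (con 0ℚ :* ((x :+ con 0ℚ :+ con 1ℚ) :* i)))) refl (fromℕ n) (recip n)
σ₁-closed n (suc M) = alg (fromℕ n) (fromℕ M) (sgn M) (u n M) (u n (suc M)) (σ w₁ n M)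
  (fromℕ-suc M) (sgn-suc M) (u-suc n M) (σ₁-closed n M)
  where
  alg : ∀ x y {Y} s {s′} U U₊ S → Y ≡ 1ℚ + y → s′ ≡ - s → U₊ * (x + y + 2ℚ) ≡ U * (x - y) →
    x * S ≡ - (s * (y * ((x + y + 1ℚ) * U))) →
    x * (S + s * (2ℚ * y + 1ℚ) * U) ≡ - (s′ * (Y * ((x + Y + 1ℚ) * U₊)))
  alg x y s U U₊ S refl refl hU ih = lin 1ℚ ih (lin (- (s * (1ℚ + y))) hU
    (solve 6 (λ x y s U U₊ S → let Y = con 1ℚ :+ y in
      x :* (S :+ s :* (con 2ℚ :* y :+ con 1ℚ) :* U)
        :+ con 1ℚ :* (:- (s :* (y :* ((x :+ y :+ con 1ℚ) :* U)))) :+ (:- (s :* Y)) :* (U :* (x :- y))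
      := :- ((:- s) :* (Y :* ((x :+ Y :+ con 1ℚ) :* U₊)))
        :+ con 1ℚ :* (x :* S) :+ (:- (s :* Y)) :* (U₊ :* (x :+ y :+ con 2ℚ)))
      refl x y s U U₊ S))

-- Beyond the support of `u` the closed form is 0. The index is `suc n` because the closed form must
-- be divided by it; at index 0 the sum is 1 for every positive cutoff.
σ₁-vanish : ∀ {n M} → suc n ℕ.< M → σ w₁ (suc n) M ≡ 0ℚ
σ₁-vanish {n} {M} n<M = *-cancelʳ-inverse (recip n) (fromℕ (suc n)) (recip-inverse n) (begin
  σ w₁ (suc n) M * fromℕ (suc n)                                            ≡⟨ *-comm (σ w₁ (suc n) M) (fromℕ (suc n)) ⟩
  fromℕ (suc n) * σ w₁ (suc n) M                                            ≡⟨ σ₁-closed (suc n) M ⟩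
  - (sgn M * (fromℕ M * ((fromℕ (suc n) + fromℕ M + 1ℚ) * u (suc n) M)))    ≡⟨ cong (λ v → - (sgn M * (fromℕ M * ((fromℕ (suc n) + fromℕ M + 1ℚ) * v)))) (u-vanish n<M) ⟩
  - (sgn M * (fromℕ M * ((fromℕ (suc n) + fromℕ M + 1ℚ) * 0ℚ)))             ≡⟨ solve 3 (λ s y x → :- (s :* (y :* ((x :+ y :+ con 1ℚ) :* con 0ℚ))) := con 0ℚ :* x) refl (sgn M) (fromℕ M) (fromℕ (suc n)) ⟩
  0ℚ * fromℕ (suc n)                                                        ∎)
  where open ≡-Reasoning

-- In `σ-shift` the inhomogeneous term is the vanishing `σ w₁`, so passing from n to n + 1
-- multiplies the sum by (2(n+1)/(2n+3))².
σ₋₁-eval : ∀ {n M} → n ℕ.< M → σ w₋₁ n M * (⟨ 3/2 ⟩ n * ⟨ 3/2 ⟩ n) ≡ ⟨ 1ℚ ⟩ n * ⟨ 1ℚ ⟩ n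
σ₋₁-eval {zero}  {suc M} _ = cong (_* (1ℚ * 1ℚ)) (σ-zero w₋₁ M)
σ₋₁-eval {suc n} {M} n<M = alg (fromℕ n) (⟨ 3/2 ⟩ n) (⟨ 1ℚ ⟩ n) (σ w₋₁ n M) (σ w₋₁ (suc n) M) (fromℕ-suc n)
  (trans (σ-shift w₋₁ w₁ w₁-from-w₋₁ n M)
         (cong (λ t → 2ℚ * 2ℚ * ((1ℚ + fromℕ n) * (1ℚ + fromℕ n)) * σ w₋₁ n M + 1ℚ * t) (σ₁-vanish n<M)))
  (σ₋₁-eval (ℕ.<-trans (ℕ.n<1+n n) n<M))
  where
  alg : ∀ x {X} D P S S′ → X ≡ 1ℚ + x →
    (2ℚ * X + 1ℚ) * (2ℚ * X + 1ℚ) * S′ ≡ 2ℚ * 2ℚ * ((1ℚ + x) * (1ℚ + x)) * S + 1ℚ * 0ℚ →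
    S * (D * D) ≡ P * P →
    S′ * (D * (3/2 + x) * (D * (3/2 + x))) ≡ P * (1ℚ + x) * (P * (1ℚ + x))
  -- The coefficient ¼ accounts for (2n+3)² = 4(3/2 + n)².
  alg x D P S S′ refl hS ih = lin (¼ * (D * D)) hS (lin ((1ℚ + x) * (1ℚ + x)) ih
    (solve 5 (λ x D P S S′ → let X = con 1ℚ :+ x; o = λ z → con 2ℚ :* z :+ con 1ℚ in
      S′ :* (D :* (con 3/2 :+ x) :* (D :* (con 3/2 :+ x)))
        :+ con ¼ :* (D :* D) :* (con 2ℚ :* con 2ℚ :* (X :* X) :* S :+ con 1ℚ :* con 0ℚ)
        :+ X :* X :* (P :* P)
      := P :* X :* (P :* X)
        :+ con ¼ :* (D :* D) :* (o X :* o X :* S′)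
        :+ X :* X :* (S :* (D :* D)))
      refl x D P S S′))

O⁽²⁾ : ℕ → ℚ
O⁽²⁾ = partialSum (λ j → 1/odd j * 1/odd j)

-- Now the inhomogeneous term in `σ-shift` is `σ w₋₁`. Divided by (2n+3)² and normalised by
-- `σ₋₁-eval`, it contributes 1/(2n+3)², the next summand of `O⁽²⁾`.
σ₋₃-eval : ∀ {n M} → n ℕ.< M →
  σ w₋₃ n M * (⟨ 3/2 ⟩ n * ⟨ 3/2 ⟩ n) ≡ ⟨ 1ℚ ⟩ n * ⟨ 1ℚ ⟩ n * O⁽²⁾ (suc n)
σ₋₃-eval {zero}  {suc M} _ = cong (_* (1ℚ * 1ℚ)) (σ-zero w₋₃ M)
σ₋₃-eval {suc n} {M} n<M = alg (fromℕ n) (⟨ 3/2 ⟩ n) (⟨ 1ℚ ⟩ n) (σ w₋₃ n M) (σ w₋₃ (suc n) M) (σ w₋₁ (suc n) M)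
  (1/odd (suc n)) (O⁽²⁾ (suc n)) (fromℕ-suc n) (1/odd-inverse (suc n))
  (σ-shift w₋₃ w₋₁ w₋₁-from-w₋₃ n M) (σ₋₁-eval n<M) (σ₋₃-eval (ℕ.<-trans (ℕ.n<1+n n) n<M))
  where
  alg : ∀ x {X} D P S S′ T θ O → X ≡ 1ℚ + x → θ * (2ℚ * X + 1ℚ) ≡ 1ℚ →
    (2ℚ * X + 1ℚ) * (2ℚ * X + 1ℚ) * S′ ≡ 2ℚ * 2ℚ * ((1ℚ + x) * (1ℚ + x)) * S + 1ℚ * T →
    T * (D * (3/2 + x) * (D * (3/2 + x))) ≡ P * (1ℚ + x) * (P * (1ℚ + x)) →
    S * (D * D) ≡ P * P * O →
    S′ * (D * (3/2 + x) * (D * (3/2 + x))) ≡ P * (1ℚ + x) * (P * (1ℚ + x)) * (O + θ * θ)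
  alg x D P S S′ T θ O refl hθ hS hT ih =
    lin (¼ * (D * D)) hS (lin ((1ℚ + x) * (1ℚ + x)) ih (lin (θ * θ) hT
    (lin (- (¼ * (D * D) * T * (θ * (2ℚ * (1ℚ + x) + 1ℚ) + 1ℚ))) hθ
    (solve 8 (λ x D P S S′ T θ O → let X = con 1ℚ :+ x; o = con 2ℚ :* X :+ con 1ℚ; Z = con 3/2 :+ x in
      S′ :* (D :* Z :* (D :* Z))
        :+ con ¼ :* (D :* D) :* (con 2ℚ :* con 2ℚ :* (X :* X) :* S :+ con 1ℚ :* T)
        :+ X :* X :* (P :* P :* O)
        :+ θ :* θ :* (P :* X :* (P :* X))
        :+ (:- (con ¼ :* (D :* D) :* T :* (θ :* o :+ con 1ℚ))) :* con 1ℚ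
      := P :* X :* (P :* X) :* (O :+ θ :* θ)
        :+ con ¼ :* (D :* D) :* (o :* o :* S′)
        :+ X :* X :* (S :* (D :* D))
        :+ θ :* θ :* (T :* (D :* Z :* (D :* Z)))
        :+ (:- (con ¼ :* (D :* D) :* T :* (θ :* o :+ con 1ℚ))) :* (θ :* o))
      refl x D P S S′ T θ O))))

-- The harmonic bracket as a sum over odd squares.

recip-square : ∀ j → 1ℤ / (suc j ℕ.^ 2) ≡ recip j * recip j
recip-square j = *-cancelʳ-inverse (recip d) (fromℕ (suc d)) (recip-inverse d)
  (trans (recip-inverse d) (sym (trans (cong (recip j * recip j *_) sq) (alg (recip j) (fromℕ (suc j)) (recip-inverse j)))))
  where
  -- The power reduces to a successor, so `suc d` equals it by computation.
  d = ℕ.pred (suc j ℕ.^ 2)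
  sq : fromℕ (suc j ℕ.^ 2) ≡ fromℕ (suc j) * (fromℕ (suc j) * 1ℚ)
  sq = trans (fromℕ-* (suc j) (suc j ℕ.* 1)) (cong (fromℕ (suc j) *_) (fromℕ-* (suc j) 1))
  alg : ∀ i x → i * x ≡ 1ℚ → i * i * (x * (x * 1ℚ)) ≡ 1ℚ
  alg i x h = lin (i * x + 1ℚ) h (solve 2 (λ i x →
    i :* i :* (x :* (x :* con 1ℚ)) :+ (i :* x :+ con 1ℚ) :* con 1ℚ := con 1ℚ :+ (i :* x :+ con 1ℚ) :* (i :* x)) refl i x)

H⁽²⁾-suc : ∀ n → H⁽²⁾ (suc n) ≡ H⁽²⁾ n + recip n * recip n
H⁽²⁾-suc n = cong (H⁽²⁾ n +_) (recip-square n)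

recip-even : ∀ k → 2ℚ * recip (1 ℕ.+ 2 ℕ.* k) ≡ recip k
recip-even k = *-cancelʳ-inverse (recip k) (1ℚ + fromℕ k) (recip-suc-inverse k)
  (alg (fromℕ k) (recip (1 ℕ.+ 2 ℕ.* k)) (recip k)
    (trans (fromℕ-suc (1 ℕ.+ 2 ℕ.* k)) (cong (1ℚ +_) (odd-fromℕ k))) (recip-inverse (1 ℕ.+ 2 ℕ.* k)) (recip-suc-inverse k))
  where
  alg : ∀ x {X} i j → X ≡ 1ℚ + (2ℚ * x + 1ℚ) → i * X ≡ 1ℚ → j * (1ℚ + x) ≡ 1ℚ → 2ℚ * i * (1ℚ + x) ≡ j * (1ℚ + x)
  alg x i j refl hi hj = lin 1ℚ hi (lin (- 1ℚ) hj (solve 3 (λ x i j → let X = con 1ℚ :+ x in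
    con 2ℚ :* i :* X :+ con 1ℚ :* con 1ℚ :+ con (- 1ℚ) :* con 1ℚ
    := j :* X :+ con 1ℚ :* (i :* (con 1ℚ :+ (con 2ℚ :* x :+ con 1ℚ))) :+ con (- 1ℚ) :* (j :* X)) refl x i j))

-- Even indices contribute 1/(2j)² = ¼ · 1/j², exactly what ¼ `H⁽²⁾ k` removes.
H⁽²⁾-odd : ∀ k → H⁽²⁾ (1 ℕ.+ 2 ℕ.* k) - ¼ * H⁽²⁾ k ≡ O⁽²⁾ (suc k)
H⁽²⁾-odd zero = refl
H⁽²⁾-odd (suc k) = begin
  H⁽²⁾ (1 ℕ.+ 2 ℕ.* suc k) - ¼ * H⁽²⁾ (suc k)       ≡⟨ cong (λ n → H⁽²⁾ (suc n) - ¼ * H⁽²⁾ (suc k)) (ℕ.*-suc 2 k) ⟩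
  H⁽²⁾ (suc (suc m)) - ¼ * H⁽²⁾ (suc k)             ≡⟨ cong₂ (λ a b → a - ¼ * b) (trans (H⁽²⁾-suc (suc m)) (cong₂ (λ a i → a + i * i) (H⁽²⁾-suc m) (cong recip (sym (ℕ.*-suc 2 k))))) (H⁽²⁾-suc k) ⟩
  H⁽²⁾ m + recip m * recip m + 1/odd (suc k) * 1/odd (suc k) - ¼ * (H⁽²⁾ k + recip k * recip k)
                                                    ≡⟨ alg (H⁽²⁾ m) (H⁽²⁾ k) (recip m) (1/odd (suc k)) (recip-even k) ⟩
  H⁽²⁾ m - ¼ * H⁽²⁾ k + 1/odd (suc k) * 1/odd (suc k)    ≡⟨ cong (_+ 1/odd (suc k) * 1/odd (suc k)) (H⁽²⁾-odd k) ⟩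
  O⁽²⁾ (suc (suc k))                                ∎
  where
  open ≡-Reasoning
  m = 1 ℕ.+ 2 ℕ.* k
  alg : ∀ H h i {j} θ → 2ℚ * i ≡ j → H + i * i + θ * θ - ¼ * (h + j * j) ≡ H - ¼ * h + θ * θ
  alg H h i θ refl = solve 4 (λ H h i θ →
    H :+ i :* i :+ θ :* θ :- con ¼ :* (h :+ con 2ℚ :* i :* (con 2ℚ :* i)) := H :- con ¼ :* h :+ θ :* θ) refl H h i θ

-- The central binomial weight and the summand.

-- q n = C(2n,n) / 4ⁿ
q : ℕ → ℚ
q zero    = 1ℚ
q (suc n) = q n * (odd n * (½ * recip n))

q-⟨⟩ : ∀ n → q n * (odd n * ⟨ 1ℚ ⟩ n) ≡ ⟨ 3/2 ⟩ n
q-⟨⟩ zero    = refl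
q-⟨⟩ (suc n) = alg (fromℕ n) (q n) (recip n) (⟨ 1ℚ ⟩ n) (⟨ 3/2 ⟩ n) (fromℕ-suc n) (recip-suc-inverse n) (q-⟨⟩ n)
  where
  alg : ∀ x {X} q i P D → X ≡ 1ℚ + x → i * (1ℚ + x) ≡ 1ℚ → q * ((2ℚ * x + 1ℚ) * P) ≡ D →
    q * ((2ℚ * x + 1ℚ) * (½ * i)) * ((2ℚ * X + 1ℚ) * (P * (1ℚ + x))) ≡ D * (3/2 + x)
  alg x q i P D refl hi ih = lin (3/2 + x) ih (lin (q * (2ℚ * x + 1ℚ) * (3/2 + x) * P) hi
    (solve 5 (λ x q i P D → let o = λ z → con 2ℚ :* z :+ con 1ℚ; X = con 1ℚ :+ x; Z = con 3/2 :+ x in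
      q :* (o x :* (con ½ :* i)) :* (o X :* (P :* X)) :+ Z :* D :+ q :* o x :* Z :* P :* con 1ℚ
      := D :* Z :+ Z :* (q :* (o x :* P)) :+ q :* o x :* Z :* P :* (i :* X)) refl x q i P D))

-- Repeats the summand of `theorem1p2` verbatim so that the two agree definitionally.
term : ℕ → ℚ
term k = (⟨ 1ℚ ⟩ k ÷ (⟨ 3/2 ⟩ k * fromℕ (1 ℕ.+ 2 ℕ.* k))) {{denom-nonZero k}} * (H⁽²⁾ (1 ℕ.+ 2 ℕ.* k) - ¼ * H⁽²⁾ k)

-- Write P = (1)ₖ and D = (3/2)ₖ. The bracket is `σ w₋₃` times D²/P², which turns the coefficient
-- P/(D(2k+1)) into D/((2k+1)P), and that is `q k`.
term-σ : ∀ {k M} → k ℕ.< M → term k ≡ q k * σ w₋₃ k M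
term-σ {k} {M} k<M = alg (⟨ 1ℚ ⟩ k) (⟨ 3/2 ⟩ k) ((1/ denom k) {{denom-nonZero k}}) (odd k) (q k) (O⁽²⁾ (suc k)) (σ w₋₃ k M)
  (odd-fromℕ k) (H⁽²⁾-odd k) (*-inverseˡ (denom k) {{denom-nonZero k}}) (σ₋₃-eval k<M) (q-⟨⟩ k)
  where
  alg : ∀ P D r {c} o q {H} O t → c ≡ o → H ≡ O → r * (D * c) ≡ 1ℚ → t * (D * D) ≡ P * P * O → q * (o * P) ≡ D →
    P * r * H ≡ q * t
  alg P D r o q O t refl refl h₁ h₂ h₃ =
    -- Multiplying q·t by (rDo)² = 1 and substituting `h₂`, then `h₃`, yields P·r·O·(rDo); the first
    -- coefficient removes the powers of rDo.
    lin (- (P * r * O) + q * t * (r * (D * o) + 1ℚ)) h₁ (lin (- (r * r * o * o * q)) h₂ (lin (- (r * r * o * O * P)) h₃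
    (solve 7 (λ P D r o q O t → let c₁ = :- (P :* r :* O) :+ q :* t :* (r :* (D :* o) :+ con 1ℚ); c₂ = :- (r :* r :* o :* o :* q); c₃ = :- (r :* r :* o :* O :* P) in
      P :* r :* O :+ c₁ :* con 1ℚ :+ c₂ :* (P :* P :* O) :+ c₃ :* D
      := q :* t :+ c₁ :* (r :* (D :* o)) :+ c₂ :* (t :* (D :* D)) :+ c₃ :* (q :* (o :* P)))
      refl P D r o q O t)))

-- Telescoping the partial sums of the series.

-- The remainder Σ_{m < M} (−1)ᵐ R n m / (2m+1)⁴.
B : ℕ → ℕ → ℚ
B n = partialSum (λ m → w₋₄ m * (q n * g n m))

-- Sums `g-step` against `w₋₄`: the factor 2m + 1 on its right side turns `w₋₄` into `w₋₃`.
B-step : ∀ n M → 2ℚ * B n M ≡ 2ℚ * B (suc n) M + q n * σ w₋₃ n M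
B-step n = partialSum-linear 2ℚ 2ℚ (q n) λ m →
  alg (fromℕ n) (sgn m) (1/odd m) (odd m) (q n) (recip n) (u n m) (g n m) (g (suc n) m)
    (1/odd-inverse m) (recip-suc-inverse n) (g-step n m)
  where
  alg : ∀ x s θ o q i U g g′ → θ * o ≡ 1ℚ → i * (1ℚ + x) ≡ 1ℚ →
    2ℚ * (1ℚ + x) * g - (2ℚ * x + 1ℚ) * g′ ≡ o * ((1ℚ + x) * U) →
    2ℚ * (s * (θ * θ * θ) * θ * (q * g))
      ≡ 2ℚ * (s * (θ * θ * θ) * θ * (q * ((2ℚ * x + 1ℚ) * (½ * i)) * g′)) + q * (s * (θ * θ * θ) * U)
  alg x s θ o q i U g g′ hθ hi hg =
    lin (q * s * (θ * θ * θ) * U) hθ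
    (lin (- (2ℚ * (s * (θ * θ * θ) * θ * (q * g))) + q * s * (θ * θ * θ) * U * (θ * o)) hi
    (lin (s * (θ * θ * θ) * θ * q * i) hg
    (solve 9 (λ x s θ o q i U g g′ → let X = con 1ℚ :+ x; θ³ = θ :* θ :* θ; c = con 2ℚ :* x :+ con 1ℚ
                                         c₁ = q :* s :* θ³ :* U
                                         c₂ = :- (con 2ℚ :* (s :* θ³ :* θ :* (q :* g))) :+ q :* s :* θ³ :* U :* (θ :* o)
                                         c₃ = s :* θ³ :* θ :* q :* i in
      con 2ℚ :* (s :* θ³ :* θ :* (q :* g)) :+ c₁ :* con 1ℚ :+ c₂ :* con 1ℚ :+ c₃ :* (o :* (X :* U))
      := con 2ℚ :* (s :* θ³ :* θ :* (q :* (c :* (con ½ :* i)) :* g′)) :+ q :* (s :* θ³ :* U)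
        :+ c₁ :* (θ :* o) :+ c₂ :* (i :* X) :+ c₃ :* (con 2ℚ :* X :* g :- c :* g′))
      refl x s θ o q i U g g′)))

-- Adds up `B-step` at one fixed cutoff; n ≤ M makes `term-σ` available for every k < n.
partialSum-term : ∀ n {M} → n ℕ.≤ M → partialSum term n + 2ℚ * B n M ≡ 2ℚ * B 0 M
partialSum-term zero    {M} _   = +-identityˡ (2ℚ * B 0 M)
partialSum-term (suc n) {M} n<M = begin
  partialSum term n + term n + 2ℚ * B (suc n) M                   ≡⟨ cong (λ a → partialSum term n + a + 2ℚ * B (suc n) M) (term-σ n<M) ⟩
  partialSum term n + q n * σ w₋₃ n M + 2ℚ * B (suc n) M          ≡⟨ solve 3 (λ a b c → a :+ b :+ c := a :+ (c :+ b)) refl (partialSum term n) (q n * σ w₋₃ n M) (2ℚ * B (suc n) M) ⟩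
  partialSum term n + (2ℚ * B (suc n) M + q n * σ w₋₃ n M)        ≡⟨ cong (partialSum term n +_) (sym (B-step n M)) ⟩
  partialSum term n + 2ℚ * B n M                                  ≡⟨ partialSum-term n (ℕ.<⇒≤ n<M) ⟩
  2ℚ * B 0 M                                                      ∎
  where open ≡-Reasoning

1/odd-fourth : ∀ m → recip (ℕ.pred ((1 ℕ.+ 2 ℕ.* m) ℕ.^ 4)) ≡ 1/odd m * 1/odd m * 1/odd m * 1/odd m
1/odd-fourth m = *-cancelʳ-inverse (recip d) (fromℕ (suc d)) (recip-inverse d)
  (trans (recip-inverse d) (sym (trans (cong (1/odd m * 1/odd m * 1/odd m * 1/odd m *_) pow) (alg (1/odd m) (fromℕ c) (recip-inverse (2 ℕ.* m))))))
  where
  c = 1 ℕ.+ 2 ℕ.* m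
  d = ℕ.pred (c ℕ.^ 4)
  pow : fromℕ (c ℕ.^ 4) ≡ fromℕ c * (fromℕ c * (fromℕ c * (fromℕ c * 1ℚ)))
  pow = trans (fromℕ-* c (c ℕ.^ 3)) (cong (fromℕ c *_) (trans (fromℕ-* c (c ℕ.^ 2)) (cong (fromℕ c *_)
        (trans (fromℕ-* c (c ℕ.^ 1)) (cong (fromℕ c *_) (fromℕ-* c 1))))))
  alg : ∀ i x → i * x ≡ 1ℚ → i * i * i * i * (x * (x * (x * (x * 1ℚ)))) ≡ 1ℚ
  alg i x h = lin ((i * x + 1ℚ) * (i * i * (x * x) + 1ℚ)) h (solve 2 (λ i x → let k = (i :* x :+ con 1ℚ) :* (i :* i :* (x :* x) :+ con 1ℚ) in
    i :* i :* i :* i :* (x :* (x :* (x :* (x :* con 1ℚ)))) :+ k :* con 1ℚ := con 1ℚ :+ k :* (i :* x)) refl i x)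

β4-term-w₋₄ : ∀ m → β4-term m ≡ w₋₄ m
β4-term-w₋₄ m = trans (/-split (-1ℤ ℤ.^ m) (ℕ.pred ((1 ℕ.+ 2 ℕ.* m) ℕ.^ 4)))
  (trans (cong (sgn m *_) (1/odd-fourth m))
         (solve 2 (λ s θ → s :* (θ :* θ :* θ :* θ) := s :* (θ :* θ :* θ) :* θ) refl (sgn m) (1/odd m)))

B-zero : ∀ M → B 0 M ≡ partialSum β4-term M
B-zero zero    = refl
B-zero (suc M) = cong₂ _+_ (B-zero M) (trans (cong (λ a → w₋₄ M * (1ℚ * a)) (g-zero M))
  (trans (solve 1 (λ w → w :* (con 1ℚ :* con 1ℚ) := w) refl (w₋₄ M)) (sym (β4-term-w₋₄ M))))

-- Bounds on the remainder.

/-mono-≤ : ∀ i j d e → i ℤ.* ℤ.+ suc e ℤ.≤ j ℤ.* ℤ.+ suc d → i / suc d ≤ j / suc e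
/-mono-≤ i j d e le = toℚᵘ-cancel-≤ (begin
  toℚᵘ (i / suc d)     ≃⟨ toℚᵘ-/ i d ⟩
  mkℚᵘ i d             ≤⟨ ℚᵘ.*≤* le ⟩
  mkℚᵘ j e             ≃⟨ toℚᵘ-/ j e ⟨
  toℚᵘ (j / suc e)     ∎)
  where open ℚᵘ.≤-Reasoning

fromℕ-mono-≤ : ∀ m n → m ℕ.≤ n → fromℕ m ≤ fromℕ n
fromℕ-mono-≤ m n m≤n = /-mono-≤ (ℤ.+ m) (ℤ.+ n) 0 0 (ℤ.*-monoʳ-≤-nonNeg 1ℤ (ℤ.+≤+ m≤n))

p≤p+q : ∀ p q .{{_ : NonNegative q}} → p ≤ p + q
p≤p+q p q = subst (_≤ p + q) (+-identityʳ p) (+-monoʳ-≤ p (nonNegative⁻¹ q))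

fromℕ-nonNeg : ∀ n → NonNegative (fromℕ n)
fromℕ-nonNeg n = normalize-nonNeg n 1

recip-nonNeg : ∀ d → NonNegative (recip d)
recip-nonNeg d = normalize-nonNeg 1 (suc d)

odd-nonNeg : ∀ n → NonNegative (odd n)
odd-nonNeg n = nonNeg+nonNeg⇒nonNeg (2ℚ * fromℕ n) {{nonNeg*nonNeg⇒nonNeg 2ℚ (fromℕ n) {{fromℕ-nonNeg n}}}} 1ℚ

q-nonNeg : ∀ n → NonNegative (q n)
q-nonNeg zero    = _
q-nonNeg (suc n) = nonNeg*nonNeg⇒nonNeg (q n) {{q-nonNeg n}} (odd n * (½ * recip n))
  {{nonNeg*nonNeg⇒nonNeg (odd n) {{odd-nonNeg n}} (½ * recip n) {{nonNeg*nonNeg⇒nonNeg ½ (recip n) {{recip-nonNeg n}}}}}}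

∣nonNeg∣ : ∀ p .{{_ : NonNegative p}} → ∣ p ∣ ≡ p
∣nonNeg∣ p = 0≤p⇒∣p∣≡p (nonNegative⁻¹ p)

∣p*q∣-mono : ∀ p q {r s} → ∣ p ∣ ≤ r → ∣ q ∣ ≤ s → ∣ p * q ∣ ≤ r * s
∣p*q∣-mono p q {r} {s} p≤r q≤s = begin
  ∣ p * q ∣        ≡⟨ ∣p*q∣≡∣p∣*∣q∣ p q ⟩
  ∣ p ∣ * ∣ q ∣    ≤⟨ *-monoʳ-≤-nonNeg ∣ q ∣ {{∣-∣-nonNeg q}} p≤r ⟩
  r * ∣ q ∣        ≤⟨ *-monoˡ-≤-nonNeg r {{nonNegative (≤-trans (0≤∣p∣ p) p≤r)}} q≤s ⟩
  r * s            ∎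
  where open ≤-Reasoning

-- Raising m multiplies the quantity by (n - m - 1)/(n + m + 2), of absolute value at most 1,
-- whether or not m exceeds n.
∣u*[n-m]∣≤1 : ∀ n m → ∣ u n m * (fromℕ n - fromℕ m) ∣ ≤ 1ℚ
∣u*[n-m]∣≤1 n zero = begin
  ∣ recip n * (fromℕ n - 0ℚ) ∣       ≡⟨ ∣p*q∣≡∣p∣*∣q∣ (recip n) (fromℕ n - 0ℚ) ⟩
  ∣ recip n ∣ * ∣ fromℕ n - 0ℚ ∣     ≡⟨ cong₂ _*_ (∣nonNeg∣ (recip n) {{recip-nonNeg n}}) (trans (cong ∣_∣ (+-identityʳ (fromℕ n))) (∣nonNeg∣ (fromℕ n) {{fromℕ-nonNeg n}})) ⟩
  recip n * fromℕ n                  ≤⟨ *-monoˡ-≤-nonNeg (recip n) {{recip-nonNeg n}} (subst (fromℕ n ≤_) (+-comm (fromℕ n) 1ℚ) (p≤p+q (fromℕ n) 1ℚ)) ⟩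
  recip n * (1ℚ + fromℕ n)           ≡⟨ recip-suc-inverse n ⟩
  1ℚ                                 ∎
  where open ≤-Reasoning
∣u*[n-m]∣≤1 n (suc m) = begin
  ∣ u n m * (x - fromℕ m) * j * (x - fromℕ (suc m)) ∣      ≡⟨ cong ∣_∣ (*-assoc (u n m * (x - fromℕ m)) j (x - fromℕ (suc m))) ⟩
  ∣ u n m * (x - fromℕ m) * (j * (x - fromℕ (suc m))) ∣    ≤⟨ ∣p*q∣-mono (u n m * (x - fromℕ m)) (j * (x - fromℕ (suc m))) (∣u*[n-m]∣≤1 n m) j-bound ⟩
  1ℚ * 1ℚ                                                  ∎
  where
  open ≤-Reasoning
  x = fromℕ n
  j = recip (suc (n ℕ.+ m))
  diff-bound : ∣ x - fromℕ (suc m) ∣ ≤ x + fromℕ m + 2ℚ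
  diff-bound = begin
    ∣ x - fromℕ (suc m) ∣          ≤⟨ ∣p-q∣≤∣p∣+∣q∣ x (fromℕ (suc m)) ⟩
    ∣ x ∣ + ∣ fromℕ (suc m) ∣      ≡⟨ cong₂ _+_ (∣nonNeg∣ x {{fromℕ-nonNeg n}}) (trans (∣nonNeg∣ (fromℕ (suc m)) {{fromℕ-nonNeg (suc m)}}) (fromℕ-suc m)) ⟩
    x + (1ℚ + fromℕ m)             ≤⟨ p≤p+q (x + (1ℚ + fromℕ m)) 1ℚ ⟩
    x + (1ℚ + fromℕ m) + 1ℚ        ≡⟨ solve 2 (λ x y → x :+ (con 1ℚ :+ y) :+ con 1ℚ := x :+ y :+ con 2ℚ) refl x (fromℕ m) ⟩
    x + fromℕ m + 2ℚ               ∎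
  j-bound : ∣ j * (x - fromℕ (suc m)) ∣ ≤ 1ℚ
  j-bound = ≤-trans (∣p*q∣-mono j (x - fromℕ (suc m)) (≤-reflexive (∣nonNeg∣ j {{recip-nonNeg (suc (n ℕ.+ m))}})) diff-bound)
                    (≤-reflexive (recip-+-inverse n m))

-- `g` starts at 1 and each increment is at most 2 in absolute value.
∣g∣≤odd : ∀ n m → ∣ g n m ∣ ≤ odd m
∣g∣≤odd n zero    = ≤-refl
∣g∣≤odd n (suc m) = begin
  ∣ g n m + 2ℚ * z ∣          ≤⟨ ∣p+q∣≤∣p∣+∣q∣ (g n m) (2ℚ * z) ⟩
  ∣ g n m ∣ + ∣ 2ℚ * z ∣      ≤⟨ +-mono-≤ (∣g∣≤odd n m) (∣p*q∣-mono 2ℚ z {2ℚ} {1ℚ} ≤-refl (∣u*[n-m]∣≤1 n m)) ⟩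
  odd m + 2ℚ * 1ℚ             ≡⟨ solve 1 (λ y → con 2ℚ :* y :+ con 1ℚ :+ con 2ℚ :* con 1ℚ := con 2ℚ :* (con 1ℚ :+ y) :+ con 1ℚ) refl (fromℕ m) ⟩
  2ℚ * (1ℚ + fromℕ m) + 1ℚ    ≡⟨ cong (λ y → 2ℚ * y + 1ℚ) (sym (fromℕ-suc m)) ⟩
  odd (suc m)                 ∎
  where
  open ≤-Reasoning
  z = u n m * (fromℕ n - fromℕ m)

∣sgn∣≡1 : ∀ k → ∣ sgn k ∣ ≡ 1ℚ
∣sgn∣≡1 zero    = refl
∣sgn∣≡1 (suc k) = trans (cong ∣_∣ (sgn-suc k)) (trans (∣-p∣≡∣p∣ (sgn k)) (∣sgn∣≡1 k))

1/odd≤1 : ∀ m → 1/odd m ≤ 1ℚ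
1/odd≤1 m = /-mono-≤ 1ℤ 1ℤ (2 ℕ.* m) 0 (ℤ.+≤+ (ℕ.s≤s ℕ.z≤n))

1/odd≤recip : ∀ m → 1/odd m ≤ recip m
1/odd≤recip m = /-mono-≤ 1ℤ 1ℤ (2 ℕ.* m) m (ℤ.*-monoˡ-≤-nonNeg 1ℤ (ℤ.+≤+ (ℕ.s≤s (ℕ.m≤m+n m (m ℕ.+ 0)))))

1/odd≤2recip : ∀ m → 1/odd m ≤ 2ℚ * recip (suc m)
1/odd≤2recip m = subst (1/odd m ≤_) (/-split (ℤ.+ 2) (suc m)) (/-mono-≤ 1ℤ (ℤ.+ 2) (2 ℕ.* m) (suc m) (ℤ.+≤+ (ℕ.≤-trans (ℕ.m≤m+n (1 ℕ.* suc (suc m)) (3 ℕ.* m)) (ℕ.≤-reflexive (lem m)))))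
  where
  lem : ∀ m → 1 ℕ.* suc (suc m) ℕ.+ 3 ℕ.* m ≡ 2 ℕ.* suc (2 ℕ.* m)
  lem = ℕ-Solver.solve-∀

recip-telescope : ∀ m → recip m * (2ℚ * recip (suc m)) ≡ 2ℚ * (recip m - recip (suc m))
recip-telescope m = alg (fromℕ m) (recip m) (recip (suc m)) (fromℕ-suc m) (recip-suc-inverse m) (recip-suc-inverse (suc m))
  where
  alg : ∀ x {X} i j → X ≡ 1ℚ + x → i * (1ℚ + x) ≡ 1ℚ → j * (1ℚ + X) ≡ 1ℚ → i * (2ℚ * j) ≡ 2ℚ * (i - j)
  alg x i j refl hi hj = lin (2ℚ * i) hj (lin (- (2ℚ * j)) hi (solve 3 (λ x i j → let X = con 1ℚ :+ x in
    i :* (con 2ℚ :* j) :+ con 2ℚ :* i :* con 1ℚ :+ (:- (con 2ℚ :* j)) :* con 1ℚ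
    := con 2ℚ :* (i :- j) :+ con 2ℚ :* i :* (j :* (con 1ℚ :+ X)) :+ (:- (con 2ℚ :* j)) :* (i :* X)) refl x i j))

-- The three factors 1/(2m+1) are bounded separately by 1, 1/(m+1) and 2/(m+2), chosen so that the
-- product telescopes.
∣w₋₃∣-bound : ∀ m → ∣ w₋₃ m ∣ ≤ 2ℚ * (recip m - recip (suc m))
∣w₋₃∣-bound m = begin
  ∣ sgn m * (θ * θ * θ) ∣                   ≤⟨ ∣p*q∣-mono (sgn m) (θ * θ * θ) (≤-reflexive (∣sgn∣≡1 m))
                                                (∣p*q∣-mono (θ * θ) θ (∣p*q∣-mono θ θ (θ≤ (1/odd≤1 m)) (θ≤ (1/odd≤recip m))) (θ≤ (1/odd≤2recip m))) ⟩
  1ℚ * (1ℚ * recip m * (2ℚ * recip (suc m))) ≡⟨ solve 2 (λ i j → con 1ℚ :* (con 1ℚ :* i :* (con 2ℚ :* j)) := i :* (con 2ℚ :* j)) refl (recip m) (recip (suc m)) ⟩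
  recip m * (2ℚ * recip (suc m))            ≡⟨ recip-telescope m ⟩
  2ℚ * (recip m - recip (suc m))            ∎
  where
  open ≤-Reasoning
  θ = 1/odd m
  θ≤ : ∀ {r} → θ ≤ r → ∣ θ ∣ ≤ r
  θ≤ = subst (_≤ _) (sym (∣nonNeg∣ θ {{recip-nonNeg (2 ℕ.* m)}}))

-- The fourth factor 1/(2m+1) in `w₋₄` absorbs the linear growth of `g`.
∣B-term∣-bound : ∀ n m → ∣ w₋₄ m * (q n * g n m) ∣ ≤ 2ℚ * (recip m - recip (suc m)) * q n
∣B-term∣-bound n m = begin
  ∣ w₋₃ m * 1/odd m * (q n * g n m) ∣            ≡⟨ cong ∣_∣ (solve 4 (λ a θ q g → a :* θ :* (q :* g) := a :* (q :* (θ :* g))) refl (w₋₃ m) (1/odd m) (q n) (g n m)) ⟩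
  ∣ w₋₃ m * (q n * (1/odd m * g n m)) ∣          ≤⟨ ∣p*q∣-mono (w₋₃ m) (q n * (1/odd m * g n m)) (∣w₋₃∣-bound m)
                                                      (∣p*q∣-mono (q n) (1/odd m * g n m) (≤-reflexive (∣nonNeg∣ (q n) {{q-nonNeg n}}))
                                                        (∣p*q∣-mono (1/odd m) (g n m) (≤-reflexive (∣nonNeg∣ (1/odd m) {{recip-nonNeg (2 ℕ.* m)}})) (∣g∣≤odd n m))) ⟩
  2ℚ * (recip m - recip (suc m)) * (q n * (1/odd m * odd m))   ≡⟨ cong (λ a → 2ℚ * (recip m - recip (suc m)) * a) (trans (cong (q n *_) (1/odd-inverse m)) (*-identityʳ (q n))) ⟩
  2ℚ * (recip m - recip (suc m)) * q n           ∎
  where open ≤-Reasoning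

-- The second summand is the unspent tail of the telescoping majorant; keeping it makes the
-- induction on M close.
∣B∣-telescoped : ∀ n M → ∣ B n M ∣ + 2ℚ * recip M * q n ≤ 2ℚ * q n
∣B∣-telescoped n zero    = ≤-reflexive (solve 1 (λ q → con 0ℚ :+ con 2ℚ :* con 1ℚ :* q := con 2ℚ :* q) refl (q n))
∣B∣-telescoped n (suc M) = begin
  ∣ B n M + b ∣ + 2ℚ * recip (suc M) * q n                    ≤⟨ +-monoˡ-≤ (2ℚ * recip (suc M) * q n) (≤-trans (∣p+q∣≤∣p∣+∣q∣ (B n M) b) (+-monoʳ-≤ ∣ B n M ∣ (∣B-term∣-bound n M))) ⟩
  ∣ B n M ∣ + 2ℚ * (recip M - recip (suc M)) * q n + 2ℚ * recip (suc M) * q n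
    ≡⟨ solve 4 (λ b i j q → b :+ con 2ℚ :* (i :- j) :* q :+ con 2ℚ :* j :* q := b :+ con 2ℚ :* i :* q) refl ∣ B n M ∣ (recip M) (recip (suc M)) (q n) ⟩
  ∣ B n M ∣ + 2ℚ * recip M * q n                              ≤⟨ ∣B∣-telescoped n M ⟩
  2ℚ * q n                                                    ∎
  where
  open ≤-Reasoning
  b = w₋₄ M * (q n * g n M)

∣B∣≤2q : ∀ n M → ∣ B n M ∣ ≤ 2ℚ * q n
∣B∣≤2q n M = ≤-trans (p≤p+q ∣ B n M ∣ (2ℚ * recip M * q n) {{nonNeg*nonNeg⇒nonNeg (2ℚ * recip M) {{nonNeg*nonNeg⇒nonNeg 2ℚ (recip M) {{recip-nonNeg M}}}} (q n) {{q-nonNeg n}}}})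
                     (∣B∣-telescoped n M)

-- Decay of the central binomial weight.

-- Consecutive values have ratio (2n+1)(2n+3)/(4(n+1)²) = 1 - 1/(4(n+1)²), so the sequence decreases
-- from 1.
q²*odd≤1 : ∀ n → q n * q n * odd n ≤ 1ℚ
q²*odd≤1 zero    = ≤-refl
q²*odd≤1 (suc n) = begin
  q (suc n) * q (suc n) * odd (suc n)    ≡⟨ cong (λ y → q (suc n) * q (suc n) * (2ℚ * y + 1ℚ)) (fromℕ-suc n) ⟩
  q (suc n) * q (suc n) * o′             ≡⟨ solve 4 (λ q o i o′ → q :* (o :* (con ½ :* i)) :* (q :* (o :* (con ½ :* i))) :* o′ := q :* q :* o :* (o :* o′ :* (con ¼ :* (i :* i)))) refl (q n) (odd n) (recip n) o′ ⟩
  q n * q n * odd n * r                  ≤⟨ *-monoʳ-≤-nonNeg r {{r-nonNeg}} (q²*odd≤1 n) ⟩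
  1ℚ * r                                 ≡⟨ *-identityˡ r ⟩
  r                                      ≤⟨ p≤p+q r (¼ * (recip n * recip n)) {{¼i²-nonNeg}} ⟩
  r + ¼ * (recip n * recip n)            ≡⟨ alg (fromℕ n) (recip n) (recip-suc-inverse n) ⟩
  1ℚ                                     ∎
  where
  open ≤-Reasoning
  o′ = 2ℚ * (1ℚ + fromℕ n) + 1ℚ
  r = odd n * o′ * (¼ * (recip n * recip n))
  ¼i²-nonNeg : NonNegative (¼ * (recip n * recip n))
  ¼i²-nonNeg = nonNeg*nonNeg⇒nonNeg ¼ (recip n * recip n) {{nonNeg*nonNeg⇒nonNeg (recip n) {{recip-nonNeg n}} (recip n) {{recip-nonNeg n}}}}
  r-nonNeg : NonNegative r
  r-nonNeg = nonNeg*nonNeg⇒nonNeg (odd n * o′) {{nonNeg*nonNeg⇒nonNeg (odd n) {{odd-nonNeg n}} o′ {{subst (λ y → NonNegative (2ℚ * y + 1ℚ)) (fromℕ-suc n) (odd-nonNeg (suc n))}}}}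
    (¼ * (recip n * recip n)) {{¼i²-nonNeg}}
  alg : ∀ x i → i * (1ℚ + x) ≡ 1ℚ → (2ℚ * x + 1ℚ) * (2ℚ * (1ℚ + x) + 1ℚ) * (¼ * (i * i)) + ¼ * (i * i) ≡ 1ℚ
  alg x i h = lin (i * (1ℚ + x) + 1ℚ) h (solve 2 (λ x i → let X = con 1ℚ :+ x in
    (con 2ℚ :* x :+ con 1ℚ) :* (con 2ℚ :* X :+ con 1ℚ) :* (con ¼ :* (i :* i)) :+ con ¼ :* (i :* i) :+ (i :* X :+ con 1ℚ) :* con 1ℚ
    := con 1ℚ :+ (i :* X :+ con 1ℚ) :* (i :* X)) refl x i)

recip-small : ∀ ε → 0ℚ < ε → ∃[ d ] recip d ≤ ε
recip-small (mkℚ (ℤ.+ zero)  d _) (*<* (ℤ.+<+ ()))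
recip-small (mkℚ ℤ.-[1+ _ ]  d _) (*<* ())
-- A positive fraction has numerator at least 1, so it dominates the reciprocal of its denominator.
recip-small (mkℚ ℤ.+[1+ p ]  d _) _ = d , toℚᵘ-cancel-≤ (ℚᵘ.≤-respˡ-≃ (ℚᵘ.≃-sym (toℚᵘ-/ 1ℤ d))
  (ℚᵘ.*≤* (ℤ.+≤+ (ℕ.*-monoˡ-≤ (suc d) {1} {suc p} (ℕ.s≤s ℕ.z≤n)))))

-- If q n ≥ ε ≥ 1/(d+1), then `q²*odd≤1` forces 2n + 1 ≤ (d+1)², which is impossible once n ≥
-- (d+1)².
q-vanishes : ∀ ε → 0ℚ < ε → ∃[ N ] (∀ n → N ℕ.≤ n → q n < ε)
q-vanishes ε 0<ε with recip-small ε 0<ε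
... | d , i≤ε = suc d ℕ.* suc d , λ n d²≤n → ≰⇒> λ ε≤q → <-irrefl refl (<-≤-trans (n<odd n)
  (≤-trans (odd≤d² n (≤-trans i≤ε ε≤q)) (fromℕ-mono-≤ (suc d ℕ.* suc d) n d²≤n)))
  where
  open ≤-Reasoning
  c = fromℕ (suc d)
  i = recip d
  n<odd : ∀ n → fromℕ n < odd n
  n<odd n = subst₂ _<_ (+-identityʳ (fromℕ n))
    (solve 1 (λ x → x :+ (x :+ con 1ℚ) := con 2ℚ :* x :+ con 1ℚ) refl (fromℕ n))
    (+-monoʳ-< (fromℕ n) (positive⁻¹ (fromℕ n + 1ℚ) {{nonNeg+pos⇒pos (fromℕ n) {{fromℕ-nonNeg n}} 1ℚ}}))
  i²≤q² : ∀ n → i ≤ q n → i * i ≤ q n * q n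
  i²≤q² n i≤q = ≤-trans (*-monoˡ-≤-nonNeg i {{recip-nonNeg d}} i≤q) (*-monoʳ-≤-nonNeg (q n) {{q-nonNeg n}} i≤q)
  cancel : ∀ i c o → i * c ≡ 1ℚ → o ≡ c * c * (i * i * o)
  cancel i c o h = lin (- (o * (i * c + 1ℚ))) h (solve 3 (λ i c o → let k = :- (o :* (i :* c :+ con 1ℚ)) in
    o :+ k :* con 1ℚ := c :* c :* (i :* i :* o) :+ k :* (i :* c)) refl i c o)
  odd≤d² : ∀ n → i ≤ q n → odd n ≤ fromℕ (suc d ℕ.* suc d)
  odd≤d² n i≤q = begin
    odd n                      ≡⟨ cancel i c (odd n) (recip-inverse d) ⟩
    c * c * (i * i * odd n)    ≤⟨ *-monoˡ-≤-nonNeg (c * c) {{nonNeg*nonNeg⇒nonNeg c {{fromℕ-nonNeg (suc d)}} c {{fromℕ-nonNeg (suc d)}}}}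
                                    (≤-trans (*-monoʳ-≤-nonNeg (odd n) {{odd-nonNeg n}} (i²≤q² n i≤q)) (q²*odd≤1 n)) ⟩
    c * c * 1ℚ                 ≡⟨ trans (*-identityʳ (c * c)) (sym (fromℕ-* (suc d) (suc d))) ⟩
    fromℕ (suc d ℕ.* suc d)    ∎

-- The error estimate and convergence.

∣2*p∣ : ∀ p → ∣ 2ℚ * p ∣ ≡ 2ℚ * ∣ p ∣
∣2*p∣ = ∣p*q∣≡∣p∣*∣q∣ 2ℚ

term-error : ∀ n m → ∣ partialSum term n - 2ℚ * partialSum β4-term m ∣
  ≤ 2ℚ * ∣ partialSum β4-term n - partialSum β4-term m ∣ + 2ℚ * (2ℚ * q n)
term-error n m = begin
  ∣ partialSum term n - 2ℚ * S m ∣                   ≡⟨ cong ∣_∣ split ⟩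
  ∣ 2ℚ * (S n - S m) - 2ℚ * B n n ∣                  ≤⟨ ∣p-q∣≤∣p∣+∣q∣ (2ℚ * (S n - S m)) (2ℚ * B n n) ⟩
  ∣ 2ℚ * (S n - S m) ∣ + ∣ 2ℚ * B n n ∣              ≡⟨ cong₂ _+_ (∣2*p∣ (S n - S m)) (∣2*p∣ (B n n)) ⟩
  2ℚ * ∣ S n - S m ∣ + 2ℚ * ∣ B n n ∣                ≤⟨ +-monoʳ-≤ (2ℚ * ∣ S n - S m ∣) (*-monoˡ-≤-nonNeg 2ℚ (∣B∣≤2q n n)) ⟩
  2ℚ * ∣ S n - S m ∣ + 2ℚ * (2ℚ * q n)               ∎
  where
  open ≤-Reasoning
  S = partialSum β4-term
  split : partialSum term n - 2ℚ * S m ≡ 2ℚ * (S n - S m) - 2ℚ * B n n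
  -- The cutoff is n itself, so the main part is twice the n-th partial sum of β(4).
  split = lin 1ℚ (trans (partialSum-term n {n} ℕ.≤-refl) (cong (2ℚ *_) (B-zero n)))
    (solve 4 (λ P Sn Sm b → P :- con 2ℚ :* Sm :+ con 1ℚ :* (con 2ℚ :* Sn)
      := con 2ℚ :* (Sn :- Sm) :- con 2ℚ :* b :+ con 1ℚ :* (P :+ con 2ℚ :* b)) refl (partialSum term n) (S n) (S m) (B n n))

⅛ : ℚ
⅛ = 1ℤ / 8

*-pos : ∀ r .{{_ : Positive r}} ε → 0ℚ < ε → 0ℚ < r * ε
*-pos r ε 0<ε = subst (_< r * ε) (*-zeroʳ r) (*-monoʳ-<-pos r 0<ε)

-- A quarter of ε goes to the partial sums of β(4), a quarter to the remainder and half to the gap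
-- demanded by `_<ℝ_`.
error-budget : ∀ ε {a b} → a < ⅛ * ε → b < ½ * (⅛ * ε) → 2ℚ * a + 2ℚ * (2ℚ * b) + ½ * ε < ε
error-budget ε {a} {b} a< b< = begin-strict
  2ℚ * a + 2ℚ * (2ℚ * b) + ½ * ε     <⟨ +-monoˡ-< (½ * ε) (+-mono-< (*-monoʳ-<-pos 2ℚ a<) (*-monoʳ-<-pos 2ℚ (*-monoʳ-<-pos 2ℚ b<))) ⟩
  2ℚ * (⅛ * ε) + 2ℚ * (2ℚ * (½ * (⅛ * ε))) + ½ * ε
    ≡⟨ solve 1 (λ ε → con 2ℚ :* (con ⅛ :* ε) :+ con 2ℚ :* (con 2ℚ :* (con ½ :* (con ⅛ :* ε))) :+ con ½ :* ε := ε) refl ε ⟩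
  ε                                  ∎
  where open ≤-Reasoning

theorem1p2 : HasSum (λ k → (⟨ 1ℚ ⟩ k ÷ (⟨ 3/2 ⟩ k * fromℕ (1 ℕ.+ 2 ℕ.* k))) {{denom-nonZero k}} * (H⁽²⁾ (1 ℕ.+ 2 ℕ.* k) - ¼ * H⁽²⁾ k)) (2ℚ · β4)
-- `½ * ε` is the separating rational. Here n counts terms of the series and m indexes the
-- approximations of `β4`.
theorem1p2 ε 0<ε = N₁ ℕ.⊔ N₂ , λ n N≤n → ½ * ε , *-pos ½ ε 0<ε , N₁ , λ m N₁≤m → close n m N≤n N₁≤m
  where
  β-close = β4-isCauchy (⅛ * ε) (*-pos ⅛ ε 0<ε)
  q-small = q-vanishes (½ * (⅛ * ε)) (*-pos ½ (⅛ * ε) (*-pos ⅛ ε 0<ε))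
  N₁ = proj₁ β-close
  N₂ = proj₁ q-small
  close : ∀ n m → N₁ ℕ.⊔ N₂ ℕ.≤ n → N₁ ℕ.≤ m → ∣ partialSum term n - 2ℚ * partialSum β4-term m ∣ + ½ * ε < ε
  close n m N≤n N₁≤m = ≤-<-trans (+-monoˡ-≤ (½ * ε) (term-error n m))
    (error-budget ε {∣ partialSum β4-term n - partialSum β4-term m ∣} {q n}
      (proj₂ β-close n m (ℕ.≤-trans (ℕ.m≤m⊔n N₁ N₂) N≤n) N₁≤m)
      (proj₂ q-small n (ℕ.≤-trans (ℕ.m≤n⊔m N₁ N₂) N≤n)))
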